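{- Let $(G,I)$ be a single interval mean-payoff game, i.e. $I$ is a single real interval. If Adam has a winning strategy then he has a positional winning strategy. If Eve has a winning strategy then she has a winning strategy that requires only finite memory.
   Context: A game graph is a tuple $G=(V,V_\exists,E,w,q_0)$ where $(V,E)$ is a finite directed graph in which every vertex has an outgoing edge, $w:E\to\mathbb{Z}$ is an integer edge-weight function, $V_\exists\subseteq V$ are Eve's vertices (the rest are Adam's), and $q_0\in V$ is the initial vertex. A play is an infinite path $\pi=v_0v_1\cdots$ with $v_0=q_0$; write $w(\pi[..k])=\sum_{i=0}^{k-1}w(v_i,v_{i+1})$. A strategy for a player maps finite play prefixes ending in one of that player's vertices to a successor vertex; it is positional if it depends only on the last vertex, and has finite memory if it can be realized as the output of a finite-state machine reading the play. The (liminf) mean-payoff is $\underline{MP}(\pi)=\liminf_{k\to\infty}\frac1k w(\pi[..k])$. A play is winning for Eve iff $\underline{MP}(\pi)\in I$, and winning for Adam otherwise; a strategy is winning for a player if every play consistent with it is winning for that player.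
   Formalization: The claim about Eve is proved under the added assumption that if I is a single point then that point is rational; for I = {α} with α irrational Eve may win but never with finite memory. The claim about Adam is for every real interval. -}

module Defs where

open import Data.Bool.Base using (Bool; true; false; T)
open import Data.Fin.Base using (Fin)
open import Data.Integer.Base as ℤ using (ℤ)
open import Data.Nat.Base as ℕ using (ℕ; zero; suc)
open import Data.Product.Base using (Σ-syntax; ∃-syntax; _×_; _,_; proj₁)
open import Data.Rational.Base as ℚ using (ℚ; 1ℚ)
open import Data.Rational.Properties as ℚₚ using (<-dense; <-trans; <-asym; <-cmp)
open import Data.Sum.Base using (_⊎_; inj₁; inj₂)
open import Data.Unit.Base using (⊤)
open import Relation.Binary.Definitions using (tri<; tri≈; tri>)
open import Relation.Binary.PropositionalEquality using (_≡_; refl; subst)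
open import Relation.Nullary using (¬_)

-- Two-sided Dedekind cuts: lower q means q < x, upper q means x < q.
record ℝ : Set₁ where
  field
    lower upper     : ℚ → Set
    lower-inhabited : ∃[ q ] lower q
    upper-inhabited : ∃[ q ] upper q
    lower-closed    : ∀ {p q} → p ℚ.< q → lower q → lower p
    upper-closed    : ∀ {p q} → p ℚ.< q → upper p → upper q
    lower-rounded   : ∀ {p} → lower p → ∃[ q ] (p ℚ.< q × lower q)
    upper-rounded   : ∀ {q} → upper q → ∃[ p ] (p ℚ.< q × upper p)
    disjoint        : ∀ {q} → ¬ (lower q × upper q)
    located         : ∀ {p q} → p ℚ.< q → lower p ⊎ upper q

open ℝ public

infix 4 _≤_ _<_ _≈_

_≤_ _<_ _≈_ : ℝ → ℝ → Set
x ≤ y = ∀ q → lower x q → lower y q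
x < y = ∃[ q ] (upper x q × lower y q)
x ≈ y = x ≤ y × y ≤ x

private
  p-1<p : ∀ p → p ℚ.- 1ℚ ℚ.< p
  p-1<p p = subst (p ℚ.- 1ℚ ℚ.<_) (ℚₚ.+-identityʳ p)
    (ℚₚ.+-monoʳ-< p (ℚₚ.negative⁻¹ (ℚ.- 1ℚ)))

  p<p+1 : ∀ p → p ℚ.< p ℚ.+ 1ℚ
  p<p+1 p = subst (ℚ._< p ℚ.+ 1ℚ) (ℚₚ.+-identityʳ p)
    (ℚₚ.+-monoʳ-< p (ℚₚ.positive⁻¹ 1ℚ))

  ℚ-located : ∀ r {p q} → p ℚ.< q → p ℚ.< r ⊎ r ℚ.< q
  ℚ-located r {p} {q} p<q with <-cmp p r
  ... | tri< p<r _ _ = inj₁ p<r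
  ... | tri≈ _ refl _ = inj₂ p<q
  ... | tri> _ _ r<p = inj₂ (<-trans r<p p<q)

fromℚ : ℚ → ℝ
fromℚ r = record
  { lower           = ℚ._< r
  ; upper           = r ℚ.<_
  ; lower-inhabited = r ℚ.- 1ℚ , p-1<p r
  ; upper-inhabited = r ℚ.+ 1ℚ , p<p+1 r
  ; lower-closed    = <-trans
  ; upper-closed    = λ p<q r<p → <-trans r<p p<q
  ; lower-rounded   = <-dense
  ; upper-rounded   = λ r<q → let (m , r<m , m<q) = <-dense r<q in m , m<q , r<m
  ; disjoint        = λ (q<r , r<q) → <-asym q<r r<q
  ; located         = ℚ-located r
  }

IsInfimum : (ℕ → ℝ) → ℝ → Set₁
IsInfimum a x = (∀ k → x ≤ a k) × (∀ y → (∀ k → y ≤ a k) → y ≤ x)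

IsSupremum : (ℕ → ℝ) → ℝ → Set₁
IsSupremum a x = (∀ k → a k ≤ x) × (∀ y → (∀ k → a k ≤ y) → x ≤ y)

-- x = supₙ inf_{k ≥ n} a k, where m n is the inner infimum.
IsLiminf : (ℕ → ℝ) → ℝ → Set₁
IsLiminf a x = Σ[ m ∈ (ℕ → ℝ) ]
  ((∀ n → IsInfimum (λ k → a (n ℕ.+ k)) (m n)) × IsSupremum m x)

data Endpoint : Set₁ where
  infinite  : Endpoint
  inclusive : ℝ → Endpoint
  exclusive : ℝ → Endpoint

record Interval : Set₁ where
  field
    left right : Endpoint

RightOf : Endpoint → ℝ → Set
RightOf infinite      x = ⊤
RightOf (inclusive a) x = a ≤ x
RightOf (exclusive a) x = a < x

LeftOf : Endpoint → ℝ → Set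
LeftOf infinite      x = ⊤
LeftOf (inclusive b) x = x ≤ b
LeftOf (exclusive b) x = x < b

infix 4 _∈ᴵ_

_∈ᴵ_ : ℝ → Interval → Set
x ∈ᴵ I = RightOf (Interval.left I) x × LeftOf (Interval.right I) x

-- If I consists of a single point, that point is rational.  This holds in
-- particular whenever I is empty, or non-degenerate, or has rational endpoints.
-- Eve can need infinite memory for I = {α} with α irrational: let her alone
-- choose, at every step, between weights 0 and 1, with 0 < α < 1.
NotIrrationalPoint : Interval → Set₁
NotIrrationalPoint I = ∀ x → x ∈ᴵ I → (∀ y → y ∈ᴵ I → y ≈ x) → ∃[ q ] x ≈ fromℚ q

data Player : Set where
  eve adam : Player

record GameGraph : Set where
  field
    order : ℕ

  V : Set
  V = Fin order

  field
    V∃ : V → Bool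
    E  : V → V → Bool

  Edge : V → V → Set
  Edge u v = T (E u v)

  field
    total : ∀ u → ∃[ v ] Edge u v
    w     : ∀ {u v} → Edge u v → ℤ
    q₀    : V

module _ (G : GameGraph) where
  open GameGraph G

  Owns : Player → V → Set
  Owns eve  v = V∃ v ≡ true
  Owns adam v = V∃ v ≡ false

  -- Finite play prefixes, indexed by their last vertex.
  data Prefix : V → Set where
    start : ∀ {v} → v ≡ q₀ → Prefix v
    _▷_   : ∀ {u v} → Prefix u → Edge u v → Prefix v

  record Play : Set where
    field
      vertex : ℕ → V
      starts : vertex 0 ≡ q₀
      step   : ∀ i → Edge (vertex i) (vertex (suc i))

  open Play

  prefix : (π : Play) (k : ℕ) → Prefix (vertex π k)
  prefix π zero    = start (starts π)
  prefix π (suc k) = prefix π k ▷ step π k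

  weight : Play → ℕ → ℤ
  weight π zero    = ℤ.0ℤ
  weight π (suc k) = weight π k ℤ.+ w (step π k)

  -- The averages are indexed from k = 1, so entry k is w(π[..k+1]) / (k+1).
  average : Play → ℕ → ℚ
  average π k = weight π (suc k) ℚ./ suc k

  IsMeanPayoff : Play → ℝ → Set₁
  IsMeanPayoff π x = IsLiminf (λ k → fromℚ (average π k)) x

  Strategy : Player → Set
  Strategy p = ∀ {v} → Prefix v → Owns p v → Σ[ u ∈ V ] Edge v u

  Consistent : ∀ {p} → Strategy p → Play → Set
  Consistent {p} σ π = ∀ k (o : Owns p (vertex π k)) →
    vertex π (suc k) ≡ proj₁ (σ (prefix π k) o)

  Positional : ∀ {p} → Strategy p → Set
  Positional {p} σ = Σ[ f ∈ (V → V) ]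
    (∀ {v} (h : Prefix v) (o : Owns p v) → proj₁ (σ h o) ≡ f v)

  record Machine : Set where
    field
      size    : ℕ
      initial : Fin size
      update  : Fin size → V → Fin size
      output  : Fin size → V

  -- The state after reading every vertex of the prefix, the last one included.
  run : (M : Machine) → ∀ {v} → Prefix v → Fin (Machine.size M)
  run M {v} (start _) = Machine.update M (Machine.initial M) v
  run M {v} (h ▷ _)   = Machine.update M (run M h) v

  FiniteMemory : ∀ {p} → Strategy p → Set
  FiniteMemory {p} σ = Σ[ M ∈ Machine ]
    (∀ {v} (h : Prefix v) (o : Owns p v) → proj₁ (σ h o) ≡ Machine.output M (run M h))

  module _ (I : Interval) where

    WonBy : Player → Play → Set₁
    WonBy eve  π = Σ[ x ∈ ℝ ] (IsMeanPayoff π x × x ∈ᴵ I)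
    WonBy adam π = ¬ WonBy eve π

    Winning : ∀ {p} → Strategy p → Set₁
    Winning {p} σ = ∀ π → Consistent {p} σ π → WonBy p π

{-# OPTIONS --safe #-}
module Submission where

-- Suppose no positional strategy of Adam wins.  Then Eve has a controller under which
-- a k - C ≤ W ≤ b k + C for all finite plays of length k and weight W, with a and b in I and a constant C;
-- this puts the mean-payoff in [a , b].  The proof is by induction on the set of moves left to Adam.
--
-- If Adam can choose between u₁ and u₂ at v, Eve has a controller for each of the two games in which one
-- of these moves is deleted.  She cuts the play at its visits to v and gives every excursion from v to the
-- controller that allows it.  The play is then a shuffle of two controlled plays, and the bounds add up.
-- (For liminf alone this would fail: the bound W ≤ b k + C, stronger than liminf ≤ b, is essential.)
--
-- If Adam has no choice left, his only strategy loses, so some play has its mean-payoff x in I.  In the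
-- strongly connected part where that play ends up, x lies between the least and the greatest cycle mean.
-- Eve either repeats one cycle whose mean is a rational point of I, or, when I = {x} with x irrational,
-- combines a cycle of mean below x with one of mean above x so as to stay near x k.

open import Algebra.Bundles using (module CommutativeRing)
import Algebra.Properties.CommutativeSemigroup as CommutativeSemigroupProperties
import Algebra.Properties.Group as GroupProperties
open import Axiom.ExcludedMiddle using (ExcludedMiddle)
open import Axiom.UniquenessOfIdentityProofs using (module Decidable⇒UIP)
open import Data.Bool.Base using (true; false)
import Data.Bool.Properties as Boolₚ
open import Data.Fin.Base as Fin using (Fin; toℕ; fromℕ<; inject≤; combine)
open import Data.Fin.Patterns using (0F; 1F)
import Data.Fin.Properties as Finₚ
open import Data.Fin.Subset as Subset using (Subset; _⊂_) renaming (_-_ to _∖_; ⊤ to full)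
open import Data.Fin.Subset.Induction using (⊂-wellFounded)
open import Data.Fin.Subset.Properties using (x∈p⇒p-x⊂p; x∈p∧x≢y⇒x∈p-y; ∈⊤)
open import Data.Integer.Base as ℤ using (+_; +[1+_]; -[1+_]; 1ℤ)
import Data.Integer.Properties as ℤₚ
import Data.Integer.Tactic.RingSolver as ℤ-Solver
open import Data.List.Base
  using (List; []; _∷_; allFin; cartesianProductWith; concatMap; filter; map; tabulate; upTo)
import Data.List.Extrema as Extrema
open import Data.List.Membership.Propositional using (_∈_; lose)
open import Data.List.Membership.Propositional.Properties
  using (∈-allFin; ∈-cartesianProductWith⁺; ∈-concatMap⁺; ∈-filter⁺; ∈-map⁺; ∈-upTo⁺)
import Data.List.Relation.Unary.All as All
open import Data.List.Relation.Unary.All.Properties using (all-filter; tabulate⁻)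
open import Data.List.Relation.Unary.Any using (here)
open import Data.Nat.Base as ℕ using (ℕ; zero; suc)
open import Data.Nat.Induction using (<-rec)
import Data.Nat.Properties as ℕₚ
open import Data.Product.Base using (Σ-syntax; ∃-syntax; _×_; _,_; proj₁; proj₂)
open import Data.Product.Function.NonDependent.Propositional using (_×-↪_)
open import Data.Rational.Base as ℚ using (ℚ; mkℚ; 0ℚ; 1ℚ; ↥_; ↧ₙ_; toℚᵘ; _+_; _*_; _-_; -_; _⊔_; _⊓_)
open import Data.Rational.Literals using (fromℤ)
import Data.Rational.Properties as ℚₚ
import Data.Rational.Unnormalised.Base as ℚᵘ
import Data.Rational.Unnormalised.Properties as ℚᵘₚ
open import Data.Sum.Base using (_⊎_; inj₁; inj₂; swap)
open import Data.Sum.Function.Propositional using (_⊎-↪_)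
open import Data.Unit.Base using (⊤; tt)
open import Function.Base using (_∘_)
open import Function.Bundles using (_↪_; module RightInverse)
open import Function.Construct.Composition using (_↪-∘_)
open import Function.Construct.Identity using (↪-id)
open import Function.Properties.Inverse using (↔-sym; ↔⇒↪)
open import Induction.WellFounded using (Acc; acc)
open import Level using (0ℓ; Lift; lift) renaming (suc to lsuc; lower to unlift)
open import Relation.Binary.Bundles using (TotalOrder; DecTotalOrder)
open import Relation.Binary.Construct.Closure.ReflexiveTransitive using (Star; ε; _◅_; _◅◅_)
open import Relation.Binary.Definitions using (tri<; tri≈; tri>)
open import Relation.Binary.PropositionalEquality
  using (_≡_; _≢_; refl; sym; trans; cong; cong₂; subst; subst₂; ≢-sym; module ≡-Reasoning)
open import Relation.Nullary using (¬_; Dec; yes; no; contradiction)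
open import Relation.Nullary.Decidable using (map′; decidable-stable; dec⇒maybe)
open import Relation.Unary using (Decidable)
open import Tactic.RingSolver using (solve-∀)
open import Tactic.RingSolver.Core.AlmostCommutativeRing using (AlmostCommutativeRing; fromCommutativeRing)
open import Defs

-- Rational arithmetic

ℚ-ring : AlmostCommutativeRing 0ℓ 0ℓ
ℚ-ring = fromCommutativeRing ℚₚ.+-*-commutativeRing λ p → dec⇒maybe (0ℚ ℚₚ.≟ p)

module +ₚ = CommutativeSemigroupProperties (CommutativeRing.+-commutativeSemigroup ℚₚ.+-*-commutativeRing)
module *ₚ = CommutativeSemigroupProperties (CommutativeRing.*-commutativeSemigroup ℚₚ.+-*-commutativeRing)

-‿involutive : ∀ p → - (- p) ≡ p
-‿involutive = GroupProperties.⁻¹-involutive ℚₚ.+-0-group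

-[-p*q]≡p*q : ∀ p q → - (- p * q) ≡ p * q
-[-p*q]≡p*q p q = trans (cong -_ (sym (ℚₚ.neg-distribˡ-* p q))) (-‿involutive (p * q))

p+q-q≡p : ∀ p q → p + q - q ≡ p
p+q-q≡p p q = GroupProperties.//-rightDividesʳ ℚₚ.+-0-group q p

p-q+q≡p : ∀ p q → p - q + q ≡ p
p-q+q≡p p q = GroupProperties.//-rightDividesˡ ℚₚ.+-0-group q p

fromℤ-+ : ∀ i j → fromℤ (i ℤ.+ j) ≡ fromℤ i + fromℤ j
fromℤ-+ i j = ℚₚ.toℚᵘ-injective (ℚᵘₚ.≃-trans (ℚᵘ.*≡* (identity i j))
  (ℚᵘₚ.≃-sym (ℚₚ.toℚᵘ-homo-+ (fromℤ i) (fromℤ j))))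
  where
  identity : ∀ i j → (i ℤ.+ j) ℤ.* 1ℤ ≡ (i ℤ.* 1ℤ ℤ.+ j ℤ.* 1ℤ) ℤ.* 1ℤ
  identity = ℤ-Solver.solve-∀

fromℤ-* : ∀ i j → fromℤ (i ℤ.* j) ≡ fromℤ i * fromℤ j
fromℤ-* i j = ℚₚ.toℚᵘ-injective (ℚᵘₚ.≃-sym (ℚₚ.toℚᵘ-homo-* (fromℤ i) (fromℤ j)))

fromℕ : ℕ → ℚ
fromℕ n = fromℤ (+ n)

fromℕ-+ : ∀ m n → fromℕ (m ℕ.+ n) ≡ fromℕ m + fromℕ n
fromℕ-+ m n = fromℤ-+ (+ m) (+ n)

fromℕ-* : ∀ m n → fromℕ (m ℕ.* n) ≡ fromℕ m * fromℕ n
fromℕ-* m n = trans (cong fromℤ (ℤₚ.pos-* m n)) (fromℤ-* (+ m) (+ n))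

fromℕ-mono-≤ : ∀ {m n} → m ℕ.≤ n → fromℕ m ℚ.≤ fromℕ n
fromℕ-mono-≤ m≤n = ℚ.*≤* (ℤₚ.*-monoʳ-≤-nonNeg 1ℤ (ℤ.+≤+ m≤n))

i/n*n≡i : ∀ i n .{{_ : ℕ.NonZero n}} → (i ℚ./ n) * fromℕ n ≡ fromℤ i
i/n*n≡i i n@(suc n-1) = ℚₚ.toℚᵘ-injective (begin
  toℚᵘ (i ℚ./ n * fromℕ n)            ≈⟨ ℚₚ.toℚᵘ-homo-* (i ℚ./ n) (fromℕ n) ⟩
  toℚᵘ (i ℚ./ n) ℚᵘ.* toℚᵘ (fromℕ n)  ≈⟨ ℚᵘₚ.*-congʳ {toℚᵘ (fromℕ n)} (ℚₚ.toℚᵘ-fromℚᵘ (ℚᵘ.mkℚᵘ i n-1)) ⟩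
  ℚᵘ.mkℚᵘ i n-1 ℚᵘ.* toℚᵘ (fromℕ n)   ≈⟨ ℚᵘ.*≡* (ℤₚ.*-assoc i (+ n) 1ℤ) ⟩
  toℚᵘ (fromℤ i)                      ∎)
  where open ℚᵘₚ.≃-Reasoning

p*↧p≡↥p : ∀ p → p * fromℕ (↧ₙ p) ≡ fromℤ (↥ p)
p*↧p≡↥p p = trans (cong (_* fromℕ (↧ₙ p)) (sym (ℚₚ.↥p/↧p≡p p))) (i/n*n≡i (↥ p) (↧ₙ p))

p<1+∣↥p∣ : ∀ p → p ℚ.< fromℕ (suc ℤ.∣ ↥ p ∣)
p<1+∣↥p∣ (mkℚ (+ n) d _)    = ℚ.*<* (subst₂ ℤ._<_ (sym (ℤₚ.*-identityʳ (+ n)))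
  (ℤₚ.pos-* (suc n) (suc d)) (ℤ.+<+ (ℕₚ.m≤m*n (suc n) (suc d))))
p<1+∣↥p∣ (mkℚ -[1+ _ ] _ _) = ℚ.*<* ℤ.-<+

archimedean : ∀ {p} → 0ℚ ℚ.< p → ∀ q → ∃[ n ] q ℚ.< fromℕ n * p
archimedean {mkℚ (+ 0) _ _}        (ℚ.*<* (ℤ.+<+ ())) _
archimedean {p@(mkℚ +[1+ a ] _ _)} _                   q = N ℕ.* ↧ₙ p , (begin-strict
  q                            <⟨ p<1+∣↥p∣ q ⟩
  fromℕ N                      ≤⟨ fromℕ-mono-≤ (ℕₚ.m≤m*n N (suc a)) ⟩
  fromℕ (N ℕ.* suc a)          ≡⟨ fromℕ-* N (suc a) ⟩
  fromℕ N * fromℕ (suc a)      ≡⟨ cong (fromℕ N *_) (p*↧p≡↥p p) ⟨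
  fromℕ N * (p * fromℕ (↧ₙ p)) ≡⟨ *ₚ.x∙yz≈xz∙y (fromℕ N) p (fromℕ (↧ₙ p)) ⟩
  fromℕ N * fromℕ (↧ₙ p) * p   ≡⟨ cong (_* p) (fromℕ-* N (↧ₙ p)) ⟨
  fromℕ (N ℕ.* ↧ₙ p) * p       ∎)
  where
  open ℚₚ.≤-Reasoning
  N : ℕ
  N = suc ℤ.∣ ↥ q ∣

commensurable : ∀ {p q} → 0ℚ ℚ.< p → 0ℚ ℚ.< q → ∃[ m ] ∃[ n ] fromℕ (suc m) * p ≡ fromℕ (suc n) * q
commensurable {mkℚ (+ 0) _ _}        {_}                    (ℚ.*<* (ℤ.+<+ ())) _
commensurable {mkℚ +[1+ _ ] _ _}     {mkℚ (+ 0) _ _}        _                   (ℚ.*<* (ℤ.+<+ ()))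
commensurable {p@(mkℚ +[1+ a ] d _)} {q@(mkℚ +[1+ b ] e _)} _                   _ =
  ℕ.pred (suc b ℕ.* suc d) , ℕ.pred (suc a ℕ.* suc e) , (begin
  fromℕ (suc b ℕ.* suc d) * p          ≡⟨ cong (_* p) (fromℕ-* (suc b) (suc d)) ⟩
  fromℕ (suc b) * fromℕ (suc d) * p    ≡⟨ *ₚ.xy∙z≈x∙zy (fromℕ (suc b)) (fromℕ (suc d)) p ⟩
  fromℕ (suc b) * (p * fromℕ (suc d))  ≡⟨ cong (fromℕ (suc b) *_) (p*↧p≡↥p p) ⟩
  fromℕ (suc b) * fromℕ (suc a)        ≡⟨ cong (_* fromℕ (suc a)) (p*↧p≡↥p q) ⟨
  q * fromℕ (suc e) * fromℕ (suc a)    ≡⟨ *ₚ.xy∙z≈zy∙x q (fromℕ (suc e)) (fromℕ (suc a)) ⟩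
  fromℕ (suc a) * fromℕ (suc e) * q    ≡⟨ cong (_* q) (fromℕ-* (suc a) (suc e)) ⟨
  fromℕ (suc a ℕ.* suc e) * q          ∎)
  where open ≡-Reasoning

p<-q⇒q<-p : ∀ {p q} → p ℚ.< - q → q ℚ.< - p
p<-q⇒q<-p {p} {q} p<-q = subst (ℚ._< - p) (-‿involutive q) (ℚₚ.neg-antimono-< p<-q)

-p<q⇒-q<p : ∀ {p q} → - p ℚ.< q → - q ℚ.< p
-p<q⇒-q<p {p} {q} -p<q = subst (- q ℚ.<_) (-‿involutive p) (ℚₚ.neg-antimono-< -p<q)

p<q⇒0<q-p : ∀ {p q} → p ℚ.< q → 0ℚ ℚ.< q - p
p<q⇒0<q-p {p} {q} p<q = subst (ℚ._< q - p) (ℚₚ.+-inverseʳ p) (ℚₚ.+-monoˡ-< (- p) p<q)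

p<q⇒p-q<0 : ∀ {p q} → p ℚ.< q → p - q ℚ.< 0ℚ
p<q⇒p-q<0 {p} {q} p<q = subst (p - q ℚ.<_) (ℚₚ.+-inverseʳ q) (ℚₚ.+-monoˡ-< (- q) p<q)

p-q<0⇒p<q : ∀ {p q} → p - q ℚ.< 0ℚ → p ℚ.< q
p-q<0⇒p<q {p} {q} p-q<0 = subst₂ ℚ._<_ (p-q+q≡p p q) (ℚₚ.+-identityˡ q) (ℚₚ.+-monoˡ-< q p-q<0)

-- The order of the reals

≤-trans : ∀ {x y z} → x ≤ y → y ≤ z → x ≤ z
≤-trans x≤y y≤z q lq = y≤z q (x≤y q lq)

lower<upper : ∀ x {p q} → lower x p → upper x q → p ℚ.< q
lower<upper x {p} {q} lp uq with ℚₚ.<-cmp p q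
... | tri< p<q _ _  = p<q
... | tri≈ _ refl _ = contradiction (lp , uq) (disjoint x)
... | tri> _ _ q<p  = contradiction (lower-closed x q<p lp , uq) (disjoint x)

≤-upper : ∀ {x y} → x ≤ y → ∀ {q} → upper y q → upper x q
≤-upper {x} {y} x≤y {q} uq with upper-rounded y uq
... | p , p<q , up with located x p<q
...   | inj₁ lp  = contradiction (x≤y p lp , up) (disjoint y)
...   | inj₂ uq′ = uq′

<⇒≤ : ∀ {x y} → x < y → x ≤ y
<⇒≤ {x} {y} (q , uq , lq) p lp = lower-closed y (lower<upper x lp uq) lq

lower⇒fromℚ≤ : ∀ x {q} → lower x q → fromℚ q ≤ x
lower⇒fromℚ≤ x lq p p<q = lower-closed x p<q lq

upper⇒≤fromℚ : ∀ x {q} → upper x q → x ≤ fromℚ q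
upper⇒≤fromℚ x uq p lp = lower<upper x lp uq

lower-⊔ : ∀ x {p q} → lower x p → lower x q → lower x (p ⊔ q)
lower-⊔ x {p} {q} lp lq with ℚₚ.⊔-sel p q
... | inj₁ ≡p = subst (lower x) (sym ≡p) lp
... | inj₂ ≡q = subst (lower x) (sym ≡q) lq

upper-⊓ : ∀ x {p q} → upper x p → upper x q → upper x (p ⊓ q)
upper-⊓ x {p} {q} up uq with ℚₚ.⊓-sel p q
... | inj₁ ≡p = subst (upper x) (sym ≡p) up
... | inj₂ ≡q = subst (upper x) (sym ≡q) uq

infix 8 -ᴿ_

-ᴿ_ : ℝ → ℝ
-ᴿ x = record
  { lower           = λ q → upper x (- q)
  ; upper           = λ q → lower x (- q)
  ; lower-inhabited = let (q , uq) = upper-inhabited x in - q , subst (upper x) (sym (-‿involutive q)) uq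
  ; upper-inhabited = let (q , lq) = lower-inhabited x in - q , subst (lower x) (sym (-‿involutive q)) lq
  ; lower-closed    = λ p<q → upper-closed x (ℚₚ.neg-antimono-< p<q)
  ; upper-closed    = λ p<q → lower-closed x (ℚₚ.neg-antimono-< p<q)
  ; lower-rounded   = λ u-p → let (q , q<-p , uq) = upper-rounded x u-p in
      - q , p<-q⇒q<-p q<-p , subst (upper x) (sym (-‿involutive q)) uq
  ; upper-rounded   = λ l-q → let (p , -q<p , lp) = lower-rounded x l-q in
      - p , -p<q⇒-q<p -q<p , subst (lower x) (sym (-‿involutive p)) lp
  ; disjoint        = λ (u , l) → disjoint x (l , u)
  ; located         = λ p<q → swap (located x (ℚₚ.neg-antimono-< p<q))
  }

-ᴿ-antimono-≤ : ∀ {x y} → x ≤ y → -ᴿ y ≤ -ᴿ x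
-ᴿ-antimono-≤ {x} {y} x≤y _ = ≤-upper {x} {y} x≤y

∈ᴵ-convex : ∀ {a x b} I → a ∈ᴵ I → b ∈ᴵ I → a ≤ x → x ≤ b → x ∈ᴵ I
∈ᴵ-convex {a} {x} {b} I (a∈ , _) (_ , b∈) a≤x x≤b =
  right-of (Interval.left I) a∈ , left-of (Interval.right I) b∈
  where
  right-of : ∀ e → RightOf e a → RightOf e x
  right-of infinite      _           = tt
  right-of (inclusive l) l≤a         = ≤-trans {l} {a} {x} l≤a a≤x
  right-of (exclusive l) (q , u , lq) = q , u , a≤x q lq

  left-of : ∀ e → LeftOf e b → LeftOf e x
  left-of infinite      _            = tt
  left-of (inclusive r) b≤r          = ≤-trans {x} {b} {r} x≤b b≤r
  left-of (exclusive r) (q , u , lq) = q , ≤-upper {x} {b} x≤b u , lq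

module ClassicalReals (em : ExcludedMiddle 0ℓ) where

  ≤-or-> : ∀ x y → x ≤ y ⊎ y < x
  ≤-or-> x y with em {y < x}
  ... | yes y<x = inj₂ y<x
  ... | no  y≮x = inj₁ x≤y
    where
    x≤y : x ≤ y
    x≤y q lq with lower-rounded x lq
    ... | q′ , q<q′ , lq′ with located y q<q′
    ...   | inj₁ lyq  = lyq
    ...   | inj₂ uyq′ = contradiction (q′ , uyq′ , lq′) y≮x

  ≉⇒<⊎> : ∀ {x y} → ¬ (y ≈ x) → x < y ⊎ y < x
  ≉⇒<⊎> {x} {y} y≉x with ≤-or-> y x | ≤-or-> x y
  ... | inj₂ x<y | _        = inj₁ x<y
  ... | inj₁ _   | inj₂ y<x = inj₂ y<x
  ... | inj₁ y≤x | inj₁ x≤y = contradiction (y≤x , x≤y) y≉x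

  cut : (L : ℚ → Set) → (∀ {p q} → p ℚ.< q → L q → L p) → ∃[ q ] L q → ∃[ q ] ¬ L q → ℝ
  cut L closed (l , Ll) (u , ¬Lu) = record
    { lower           = λ q → ∃[ q′ ] (q ℚ.< q′ × L q′)
    ; upper           = λ q → ∃[ q′ ] (q′ ℚ.< q × ¬ L q′)
    ; lower-inhabited = let (p , p<l) = lower-inhabited (fromℚ l) in p , l , p<l , Ll
    ; upper-inhabited = let (q , u<q) = upper-inhabited (fromℚ u) in q , u , u<q , ¬Lu
    ; lower-closed    = λ p<q (q′ , q<q′ , Lq′) → q′ , ℚₚ.<-trans p<q q<q′ , Lq′
    ; upper-closed    = λ p<q (p′ , p′<p , ¬Lp′) → p′ , ℚₚ.<-trans p′<p p<q , ¬Lp′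
    ; lower-rounded   = λ (q′ , q<q′ , Lq′) →
        let (m , q<m , m<q′) = ℚₚ.<-dense q<q′ in m , q<m , q′ , m<q′ , Lq′
    ; upper-rounded   = λ (q′ , q′<q , ¬Lq′) →
        let (m , q′<m , m<q) = ℚₚ.<-dense q′<q in m , m<q , q′ , q′<m , ¬Lq′
    ; disjoint        = λ ((l′ , q<l′ , Ll′) , (u′ , u′<q , ¬Lu′)) → ¬Lu′ (closed (ℚₚ.<-trans u′<q q<l′) Ll′)
    ; located         = λ p<q → decide (ℚₚ.<-dense p<q)
    }
    where
    decide : ∀ {p q} → ∃[ m ] (p ℚ.< m × m ℚ.< q) →
      ∃[ p′ ] (p ℚ.< p′ × L p′) ⊎ ∃[ q′ ] (q′ ℚ.< q × ¬ L q′)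
    decide (m , p<m , m<q) with em {L m}
    ... | yes Lm = inj₁ (m , p<m , Lm)
    ... | no ¬Lm = inj₂ (m , m<q , ¬Lm)

  infimum : (a : ℕ → ℝ) → ∃[ q ] (∀ k → lower (a k) q) → Σ[ x ∈ ℝ ] IsInfimum a x
  infimum a bounded-below = x , (λ k q (q′ , q<q′ , l) → lower-closed (a k) q<q′ (l k)) ,
      λ y y≤a q lq → let (q′ , q<q′ , lq′) = lower-rounded y lq in q′ , q<q′ , λ k → y≤a k q′ lq′
    where
    x : ℝ
    x = cut (λ q → ∀ k → lower (a k) q) (λ p<q l k → lower-closed (a k) p<q (l k)) bounded-below
      (let (q , u) = upper-inhabited (a 0) in q , λ l → disjoint (a 0) (l 0 , u))

  supremum : (a : ℕ → ℝ) → ∃[ q ] (∀ k → upper (a k) q) → Σ[ x ∈ ℝ ] IsSupremum a x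
  supremum a (u , bounded-above) = x ,
      (λ k q lq → let (q′ , q<q′ , lq′) = lower-rounded (a k) lq in q′ , q<q′ , k , lq′) ,
      λ y a≤y q (q′ , q<q′ , k , l) → lower-closed y q<q′ (a≤y k q′ l)
    where
    x : ℝ
    x = cut (λ q → ∃[ k ] lower (a k) q) (λ p<q (k , l) → k , lower-closed (a k) p<q l)
      (let (q , l) = lower-inhabited (a 0) in q , 0 , l)
      (u , λ (k , l) → disjoint (a k) (l , bounded-above k))

  liminf : (a : ℕ → ℝ) → ∃[ q ] (∀ k → lower (a k) q) → ∃[ q ] (∀ k → upper (a k) q) →
    Σ[ x ∈ ℝ ] IsLiminf a x
  liminf a (l , below) (u , above) = let (x , sup) = supremum m (u , m-above) in x , m , inf , sup
    where
    infimum-from : ∀ n → Σ[ y ∈ ℝ ] IsInfimum (λ k → a (n ℕ.+ k)) y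
    infimum-from n = infimum (λ k → a (n ℕ.+ k)) (l , λ k → below (n ℕ.+ k))
    m : ℕ → ℝ
    m n = proj₁ (infimum-from n)
    inf : ∀ n → IsInfimum (λ k → a (n ℕ.+ k)) (m n)
    inf n = proj₂ (infimum-from n)
    m-above : ∀ n → upper (m n) u
    m-above n = ≤-upper {m n} {a (n ℕ.+ 0)} (proj₁ (inf n) 0) (above (n ℕ.+ 0))

-- Linear bounds

*-distribˡ-fromℕ-+ : ∀ r m n → r * fromℕ (m ℕ.+ n) ≡ r * fromℕ m + r * fromℕ n
*-distribˡ-fromℕ-+ r m n = trans (cong (r *_) (fromℕ-+ m n)) (ℚₚ.*-distribˡ-+ r (fromℕ m) (fromℕ n))

*-fromℕ-monoˡ-≤ : ∀ k {p q} → p ℚ.≤ q → p * fromℕ k ℚ.≤ q * fromℕ k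
*-fromℕ-monoˡ-≤ k = ℚₚ.*-monoʳ-≤-nonNeg (fromℕ k)

absorb-eventually : ∀ {r r′} → r ℚ.< r′ → ∀ C → ∃[ K ] (∀ {k W} → K ℕ.≤ k →
  r′ * fromℕ k ℚ.≤ W + C → r * fromℕ k ℚ.≤ W)
absorb-eventually {r} {r′} r<r′ C = K , absorbed
  where
  open ℚₚ.≤-Reasoning

  0<r′-r : 0ℚ ℚ.< r′ - r
  0<r′-r = p<q⇒0<q-p r<r′

  K : ℕ
  K = proj₁ (archimedean 0<r′-r C)

  C≤ : ∀ {k} → K ℕ.≤ k → C ℚ.≤ fromℕ k * (r′ - r)
  C≤ {k} K≤k = begin
    C                  ≤⟨ ℚₚ.<⇒≤ (proj₂ (archimedean 0<r′-r C)) ⟩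
    fromℕ K * (r′ - r) ≤⟨ ℚₚ.*-monoʳ-≤-nonNeg (r′ - r) {{ℚ.nonNegative (ℚₚ.<⇒≤ 0<r′-r)}} (fromℕ-mono-≤ K≤k) ⟩
    fromℕ k * (r′ - r) ∎

  split : ∀ r r′ k → r * k ≡ r′ * k - k * (r′ - r)
  split = solve-∀ ℚ-ring

  absorbed : ∀ {k W} → K ℕ.≤ k → r′ * fromℕ k ℚ.≤ W + C → r * fromℕ k ℚ.≤ W
  absorbed {k} {W} K≤k h = begin
    r * fromℕ k                             ≡⟨ split r r′ (fromℕ k) ⟩
    r′ * fromℕ k - fromℕ k * (r′ - r)       ≤⟨ ℚₚ.+-mono-≤ h (ℚₚ.neg-antimono-≤ (C≤ K≤k)) ⟩
    W + C - C                               ≡⟨ p+q-q≡p W C ⟩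
    W                                       ∎

-- Above a C k W says a k ≤ W + C, and Below b C k W says W ≤ b k + C.
record Above (a : ℝ) (C : ℚ) (k : ℕ) (W : ℚ) : Set where
  constructor above⁺
  field above⁻ : ∀ {r} → lower a r → r * fromℕ k ℚ.≤ W + C

open Above public

Below : ℝ → ℚ → ℕ → ℚ → Set
Below b C k W = Above (-ᴿ b) C k (- W)

above-antimono : ∀ {a a′ C k W} → a′ ≤ a → Above a C k W → Above a′ C k W
above-antimono a′≤a b = above⁺ λ l → above⁻ b (a′≤a _ l)

above-weaken : ∀ {a C C′ k W} → C ℚ.≤ C′ → Above a C k W → Above a C′ k W
above-weaken {W = W} C≤C′ b = above⁺ λ l → ℚₚ.≤-trans (above⁻ b l) (ℚₚ.+-monoʳ-≤ W C≤C′)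

above-+ : ∀ {a C C′ k k′ W W′} → Above a C k W → Above a C′ k′ W′ →
  Above a (C + C′) (k ℕ.+ k′) (W + W′)
above-+ {C = C} {C′} {k} {k′} {W} {W′} b b′ = above⁺ λ {r} l → begin
  r * fromℕ (k ℕ.+ k′)        ≡⟨ *-distribˡ-fromℕ-+ r k k′ ⟩
  r * fromℕ k + r * fromℕ k′  ≤⟨ ℚₚ.+-mono-≤ (above⁻ b l) (above⁻ b′ l) ⟩
  (W + C) + (W′ + C′)         ≡⟨ +ₚ.interchange W C W′ C′ ⟩
  (W + W′) + (C + C′)         ∎
  where open ℚₚ.≤-Reasoning

above-exists : ∀ a k W → ∃[ C ] Above a C k W
above-exists a k W = let (q , u) = upper-inhabited a in q * fromℕ k - W , above⁺ λ {r} l → begin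
  r * fromℕ k           ≤⟨ *-fromℕ-monoˡ-≤ k (ℚₚ.<⇒≤ (lower<upper a l u)) ⟩
  q * fromℕ k           ≡⟨ complete (q * fromℕ k) W ⟩
  W + (q * fromℕ k - W) ∎
  where
  open ℚₚ.≤-Reasoning
  complete : ∀ p W → p ≡ W + (p - W)
  complete = solve-∀ ℚ-ring

above-detach : ∀ a k₀ W₀ → ∃[ D ] (∀ {C k} W → Above a C (k ℕ.+ k₀) (W + W₀) → Above a (C + D) k W)
above-detach a k₀ W₀ = W₀ - r₀ * fromℕ k₀ , λ W b → above⁺ (detached W b)
  where
  open ℚₚ.≤-Reasoning
  r₀ : ℚ
  r₀ = proj₁ (lower-inhabited a)

  steep : ∀ {C k} W {r} → r₀ ℚ.≤ r → r * fromℕ (k ℕ.+ k₀) ℚ.≤ (W + W₀) + C →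
    r * fromℕ k ℚ.≤ W + (C + (W₀ - r₀ * fromℕ k₀))
  steep {C} {k} W {r} r₀≤r h = begin
    r * fromℕ k                                  ≡⟨ p+q-q≡p (r * fromℕ k) (r * fromℕ k₀) ⟨
    (r * fromℕ k + r * fromℕ k₀) - r * fromℕ k₀  ≡⟨ cong (_- r * fromℕ k₀) (*-distribˡ-fromℕ-+ r k k₀) ⟨
    r * fromℕ (k ℕ.+ k₀) - r * fromℕ k₀
      ≤⟨ ℚₚ.+-mono-≤ h (ℚₚ.neg-antimono-≤ (*-fromℕ-monoˡ-≤ k₀ r₀≤r)) ⟩
    (W + W₀) + C - r₀ * fromℕ k₀                 ≡⟨ regroup W W₀ C (r₀ * fromℕ k₀) ⟩
    W + (C + (W₀ - r₀ * fromℕ k₀))               ∎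
    where
    regroup : ∀ W W₀ C p → (W + W₀) + C - p ≡ W + (C + (W₀ - p))
    regroup = solve-∀ ℚ-ring

  detached : ∀ {C k} W {r} → Above a C (k ℕ.+ k₀) (W + W₀) → lower a r →
    r * fromℕ k ℚ.≤ W + (C + (W₀ - r₀ * fromℕ k₀))
  detached {C} {k} W {r} b l with ℚₚ.≤-total r₀ r
  ... | inj₁ r₀≤r = steep {C} W r₀≤r (above⁻ b l)
  ... | inj₂ r≤r₀ = ℚₚ.≤-trans (*-fromℕ-monoˡ-≤ k r≤r₀)
    (steep {C} W ℚₚ.≤-refl (above⁻ b (proj₂ (lower-inhabited a))))

≤fromℚ⇒above : ∀ {a q k W} → a ≤ fromℚ q → q * fromℕ k ℚ.≤ W → Above a 0ℚ k W
≤fromℚ⇒above {k = k} {W} a≤q h = above⁺ λ l →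
  ℚₚ.≤-trans (*-fromℕ-monoˡ-≤ k (ℚₚ.<⇒≤ (a≤q _ l))) (subst (_ ℚ.≤_) (sym (ℚₚ.+-identityʳ W)) h)

fromℚ≤⇒-ᴿ≤fromℚ- : ∀ {q b} → fromℚ q ≤ b → -ᴿ b ≤ fromℚ (- q)
fromℚ≤⇒-ᴿ≤fromℚ- {q} {b} q≤b r u = p<-q⇒q<-p (≤-upper {fromℚ q} {b} q≤b u)

fromℚ-above⇒below : ∀ q {C k W} → Above (fromℚ q) C k (- W) → Below (fromℚ (- q)) C k W
fromℚ-above⇒below q = above-antimono (subst (λ p → -ᴿ fromℚ (- q) ≤ fromℚ p) (-‿involutive q)
  (fromℚ≤⇒-ᴿ≤fromℚ- { - q} {fromℚ (- q)} λ _ l → l))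

fromℚ≤⇒below : ∀ b {q k W} → fromℚ q ≤ b → W ℚ.≤ q * fromℕ k → Below b 0ℚ k W
fromℚ≤⇒below b {q} {k} {W} q≤b h = ≤fromℚ⇒above (fromℚ≤⇒-ᴿ≤fromℚ- {q} {b} q≤b)
  (subst (ℚ._≤ - W) (ℚₚ.neg-distribˡ-* q (fromℕ k)) (ℚₚ.neg-antimono-≤ h))

¬above⇒below : ∀ x {k W} → ¬ Above x 0ℚ k W → Below x 0ℚ k W
¬above⇒below x {k} {W} ¬above = above⁺ below
  where
  below : ∀ {r} → upper x (- r) → r * fromℕ k ℚ.≤ - W + 0ℚ
  below {r} u with ℚₚ.≤-total (- r * fromℕ k) W
  ... | inj₁ -r*k≤W = contradiction (≤fromℚ⇒above (upper⇒≤fromℚ x u) -r*k≤W) ¬above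
  ... | inj₂ W≤-r*k =
    subst₂ ℚ._≤_ (-[-p*q]≡p*q r (fromℕ k)) (sym (ℚₚ.+-identityʳ (- W))) (ℚₚ.neg-antimono-≤ W≤-r*k)

record Within (a b : ℝ) (C : ℚ) (k : ℕ) (W : ℚ) : Set where
  constructor _,_
  field
    within-above : Above a C k W
    within-below : Below b C k W

open Within public

below-+ : ∀ {b C C′ k k′ W W′} → Below b C k W → Below b C′ k′ W′ → Below b (C + C′) (k ℕ.+ k′) (W + W′)
below-+ {W = W} {W′} h h′ = subst (Above _ _ _) (sym (ℚₚ.neg-distrib-+ W W′)) (above-+ h h′)

module _ {a b : ℝ} where

  within-+ : ∀ {C C′ k k′ W W′} → Within a b C k W → Within a b C′ k′ W′ →
    Within a b (C + C′) (k ℕ.+ k′) (W + W′)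
  within-+ {W = W} {W′} (h , g) (h′ , g′) = above-+ h h′ , below-+ {b = b} {W = W} {W′} g g′

  within-weaken : ∀ {C C′ k W} → C ℚ.≤ C′ → Within a b C k W → Within a b C′ k W
  within-weaken C≤C′ (h , g) = above-weaken C≤C′ h , above-weaken C≤C′ g

  within-+-down : ∀ {C C′ k k′ W W′} → C′ ℚ.≤ C → Above a 0ℚ k W → Below b C k W →
    Above a C′ k′ W′ → Below b 0ℚ k′ W′ → Within a b C (k ℕ.+ k′) (W + W′)
  within-+-down {C} {C′} {W = W} {W′} C′≤C above₀ below above′ below₀′ =
    above-weaken (subst (ℚ._≤ C) (sym (ℚₚ.+-identityˡ C′)) C′≤C) (above-+ above₀ above′) ,
    above-weaken (ℚₚ.≤-reflexive (ℚₚ.+-identityʳ C)) (below-+ {b} {W = W} {W′} below below₀′)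

  within-+-up : ∀ {C C′ k k′ W W′} → C′ ℚ.≤ C → Above a C k W → Below b 0ℚ k W →
    Above a 0ℚ k′ W′ → Below b C′ k′ W′ → Within a b C (k ℕ.+ k′) (W + W′)
  within-+-up {C} {C′} {W = W} {W′} C′≤C above below₀ above₀′ below′ =
    above-weaken (ℚₚ.≤-reflexive (ℚₚ.+-identityʳ C)) (above-+ above above₀′) ,
    above-weaken (subst (ℚ._≤ C) (sym (ℚₚ.+-identityˡ C′)) C′≤C) (below-+ {b} {W = W} {W′} below₀ below′)

  within-mono : ∀ {a′ b′ C k W} → a′ ≤ a → b ≤ b′ → Within a b C k W → Within a′ b′ C k W
  within-mono {b′ = b′} a′≤a b≤b′ (h , g) =
    above-antimono a′≤a h , above-antimono (-ᴿ-antimono-≤ {b} {b′} b≤b′) g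

  within-exists : ∀ k W → ∃[ C ] Within a b C k W
  within-exists k W =
    let (C , h) = above-exists a k W ; (C′ , g) = above-exists (-ᴿ b) k (- W) in
    C ⊔ C′ , (above-weaken (ℚₚ.p≤p⊔q C C′) h , above-weaken (ℚₚ.p≤q⊔p C C′) g)

  within-detach : ∀ k₀ W₀ → ∃[ D ] (∀ {C k} W → Within a b C (k ℕ.+ k₀) (W + W₀) → Within a b (C + D) k W)
  within-detach k₀ W₀ =
    let (D , detach) = above-detach a k₀ W₀ ; (D′ , detach′) = above-detach (-ᴿ b) k₀ (- W₀) in
    D ⊔ D′ , λ {C} W (h , g) →
      above-weaken (ℚₚ.+-monoʳ-≤ C (ℚₚ.p≤p⊔q D D′)) (detach W h) ,
      above-weaken (ℚₚ.+-monoʳ-≤ C (ℚₚ.p≤q⊔p D D′))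
        (detach′ (- W) (subst (Above _ _ _) (ℚₚ.neg-distrib-+ W W₀) g))

within-mean : ∀ {c k W} → c * fromℕ k ≡ W → Within (fromℚ c) (fromℚ c) 0ℚ k W
within-mean {c} c*k≡W = ≤fromℚ⇒above (λ _ l → l) (ℚₚ.≤-reflexive c*k≡W) ,
  fromℚ≤⇒below (fromℚ c) {c} (λ _ l → l) (ℚₚ.≤-reflexive (sym c*k≡W))

-- Limits inferior of averages

above-eventually : ∀ {a C N q} {W : ℕ → ℚ} → (∀ k → N ℕ.≤ k → Above a C k (W k)) → lower a q →
  ∃[ K ] (∀ k → K ℕ.≤ k → q * fromℕ k ℚ.≤ W k)
above-eventually {a} {C} {N} bounds l =
  let (q′ , q<q′ , l′) = lower-rounded a l ; (K , absorb) = absorb-eventually q<q′ C in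
  N ℕ.⊔ K , λ k N⊔K≤k → absorb (ℕₚ.m⊔n≤o⇒n≤o N K N⊔K≤k) (above⁻ (bounds k (ℕₚ.m⊔n≤o⇒m≤o N K N⊔K≤k)) l′)

above-absorb : ∀ {a C k W r} → Above a C (suc k) W → lower a r →
  (r - fromℕ (suc ℤ.∣ ↥ C ∣)) * fromℕ (suc k) ℚ.≤ W
above-absorb {a} {C} {k} {W} {r} b l = begin
  (r - fromℕ N) * fromℕ (suc k)                   ≡⟨ expand r (fromℕ N) (fromℕ (suc k)) ⟩
  r * fromℕ (suc k) - fromℕ N * fromℕ (suc k)     ≤⟨ ℚₚ.+-mono-≤ (above⁻ b l) (ℚₚ.neg-antimono-≤ C≤N*k) ⟩
  W + C - C                                       ≡⟨ p+q-q≡p W C ⟩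
  W                                               ∎
  where
  open ℚₚ.≤-Reasoning
  N : ℕ
  N = suc ℤ.∣ ↥ C ∣

  C≤N*k : C ℚ.≤ fromℕ N * fromℕ (suc k)
  C≤N*k = begin
    C                         ≤⟨ ℚₚ.<⇒≤ (p<1+∣↥p∣ C) ⟩
    fromℕ N                   ≤⟨ fromℕ-mono-≤ (ℕₚ.m≤m*n N (suc k)) ⟩
    fromℕ (N ℕ.* suc k)       ≡⟨ fromℕ-* N (suc k) ⟩
    fromℕ N * fromℕ (suc k)   ∎

  expand : ∀ r n k → (r - n) * k ≡ r * k - n * k
  expand = solve-∀ ℚ-ring

module LiminfOfAverages (W average : ℕ → ℚ)
  (average*k≡W : ∀ k → average k * fromℕ (suc k) ≡ W (suc k)) where

  ≤average : ∀ {q k} → q * fromℕ (suc k) ℚ.≤ W (suc k) → q ℚ.≤ average k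
  ≤average {q} {k} q*k≤W = ℚₚ.*-cancelʳ-≤-pos (fromℕ (suc k))
    (subst (q * fromℕ (suc k) ℚ.≤_) (sym (average*k≡W k)) q*k≤W)

  average≤ : ∀ {q k} → (- q) * fromℕ (suc k) ℚ.≤ - W (suc k) → average k ℚ.≤ q
  average≤ {q} {k} -q*k≤-W = ℚₚ.*-cancelʳ-≤-pos (fromℕ (suc k))
    (subst₂ ℚ._≤_ (trans (-‿involutive (W (suc k))) (sym (average*k≡W k))) (-[-p*q]≡p*q q (fromℕ (suc k)))
      (ℚₚ.neg-antimono-≤ -q*k≤-W))

  liminf-≥ : ∀ {a x C N} → IsLiminf (λ k → fromℚ (average k)) x →
    (∀ k → N ℕ.≤ k → Above a C k (W k)) → a ≤ x
  liminf-≥ {a} (m , inf , sup) bounds q l =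
    let (q′ , q<q′ , l′) = lower-rounded a l ; (K , eventually) = above-eventually bounds l′ in
    proj₁ sup K q (proj₂ (inf K) (fromℚ q′) (λ j p p<q′ → ℚₚ.<-≤-trans p<q′ (≤average
      (eventually (suc (K ℕ.+ j)) (ℕₚ.m≤n⇒m≤1+n (ℕₚ.m≤m+n K j))))) q q<q′)

  liminf-≤ : ∀ {b x C N} → IsLiminf (λ k → fromℚ (average k)) x →
    (∀ k → N ℕ.≤ k → Below b C k (W k)) → x ≤ b
  liminf-≤ {b} (m , inf , sup) bounds = proj₂ sup b m≤b
    where
    upper⇒≮ : ∀ n {q} → upper b q → ¬ lower (m n) q
    upper⇒≮ n {q} u l = ℚₚ.<-irrefl refl (ℚₚ.<-≤-trans (proj₁ (inf n) K q l) average≤q)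
      where
      eventually-below : ∃[ K ] (∀ k → K ℕ.≤ k → - q * fromℕ k ℚ.≤ - W k)
      eventually-below = above-eventually bounds (subst (upper b) (sym (-‿involutive q)) u)

      K : ℕ
      K = proj₁ eventually-below

      average≤q : average (n ℕ.+ K) ℚ.≤ q
      average≤q = average≤ (proj₂ eventually-below (suc (n ℕ.+ K)) (ℕₚ.m≤n⇒m≤1+n (ℕₚ.m≤n+m K n)))

    m≤b : ∀ n → m n ≤ b
    m≤b n q l with lower-rounded (m n) l
    ... | q′ , q<q′ , l′ with located b q<q′
    ...   | inj₁ lb = lb
    ...   | inj₂ ub = contradiction l′ (upper⇒≮ n ub)

  within⇒liminf : ExcludedMiddle 0ℓ → ∀ {a b C} → (∀ k → Within a b C k (W k)) →
    Σ[ x ∈ ℝ ] IsLiminf (λ k → fromℚ (average k)) x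
  within⇒liminf em {a} {b} {C} bounds = liminf (λ k → fromℚ (average k))
    (let (q , q<l) = lower-inhabited (fromℚ l) in q , λ k → ℚₚ.<-≤-trans q<l (l≤average k))
    (let (q , -u<q) = upper-inhabited (fromℚ (- u)) in q , λ k → ℚₚ.≤-<-trans (average≤-u k) -u<q)
    where
    open ClassicalReals em
    N r s l u : ℚ
    N = fromℕ (suc ℤ.∣ ↥ C ∣)
    r = proj₁ (lower-inhabited a)
    s = proj₁ (lower-inhabited (-ᴿ b))
    l = r - N
    u = s - N

    l≤average : ∀ k → l ℚ.≤ average k
    l≤average k = ≤average (above-absorb (within-above (bounds (suc k))) (proj₂ (lower-inhabited a)))

    average≤-u : ∀ k → average k ℚ.≤ - u
    average≤-u k = average≤ (subst (λ p → p * fromℕ (suc k) ℚ.≤ - W (suc k)) (sym (-‿involutive u))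
      (above-absorb (within-below (bounds (suc k))) (proj₂ (lower-inhabited (-ᴿ b)))))

-- Extrema over finite sets

ℚ-totalOrder : TotalOrder 0ℓ 0ℓ 0ℓ
ℚ-totalOrder = DecTotalOrder.totalOrder ℚₚ.≤-decTotalOrder

module _ {c ℓ₁ ℓ₂} (O : TotalOrder c ℓ₁ ℓ₂) where
  open TotalOrder O renaming (Carrier to A; _≤_ to _≼_)
  open Extrema O using (argmin; argmin-all; f[argmin]≤f[xs]; max; xs≤max)

  uniform-bound : A → ∀ {n} {P : Fin n → A → Set} → (∀ i {x y} → x ≼ y → P i x → P i y) →
    (∀ i → ∃[ x ] P i x) → ∃[ x ] (∀ i → P i x)
  uniform-bound x₀ mono p = max x₀ xs , λ i → mono i (tabulate⁻ (xs≤max x₀ xs) i) (proj₂ (p i))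
    where
    xs : List A
    xs = tabulate (λ i → proj₁ (p i))

  minimum-in : ∀ {B : Set} (f : B → A) {P : B → Set} → Decidable P → ∀ xs → ∃[ x ] P x →
    ∃[ x ] (P x × (∀ {y} → y ∈ xs → P y → f x ≼ f y))
  minimum-in f P? xs (x₀ , Px₀) = argmin f x₀ (filter P? xs) , argmin-all f Px₀ (all-filter P? xs) ,
    λ y∈xs Py → All.lookup (f[argmin]≤f[xs] x₀ (filter P? xs)) (∈-filter⁺ P? y∈xs Py)

-- Walks

infixr 5 _∷_

data Walk {V : Set} (R : V → V → Set) (ω : V → V → ℚ) : V → V → ℕ → ℚ → Set where
  []  : ∀ {u} → Walk R ω u u 0 0ℚ
  _∷_ : ∀ {u v x k W} → R u v → Walk R ω v x k W → Walk R ω u x (suc k) (ω u v + W)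

module _ {V : Set} {R : V → V → Set} where

  star⇒walk : ∀ ω {u v} → Star R u v → ∃[ k ] ∃[ W ] Walk R ω u v k W
  star⇒walk ω ε         = _ , _ , []
  star⇒walk ω (e ◅ u⇝v) = let (_ , _ , γ) = star⇒walk ω u⇝v in _ , _ , e ∷ γ

  walk⇒star : ∀ {ω u v k W} → Walk R ω u v k W → Star R u v
  walk⇒star []      = ε
  walk⇒star (e ∷ γ) = e ◅ walk⇒star γ

opposite : {V : Set} → (V → V → ℚ) → V → V → ℚ
opposite ω u v = - ω u v

module _ {V : Set} {R : V → V → Set} where

  negate-walk : ∀ {ω ω⁻ : V → V → ℚ} → (∀ u v → ω⁻ u v ≡ - ω u v) → ∀ {u v k W} →
    Walk R ω u v k W → Walk R ω⁻ u v k (- W)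
  negate-walk          ω⁻≡ []                        = []
  negate-walk {ω} {ω⁻} ω⁻≡ (_∷_ {u = u} {v} {W = W} e γ) =
    subst (Walk R ω⁻ _ _ _) (trans (cong (_+ - W) (ω⁻≡ u v)) (sym (ℚₚ.neg-distrib-+ (ω u v) W)))
      (e ∷ negate-walk ω⁻≡ γ)

  oppose-walk : ∀ {ω u v k W} → Walk R ω u v k W → Walk R (opposite ω) u v k (- W)
  oppose-walk = negate-walk λ _ _ → refl

  unoppose-walk : ∀ {ω u v k W} → Walk R (opposite ω) u v k W → Walk R ω u v k (- W)
  unoppose-walk {ω} = negate-walk λ u v → sym (-‿involutive (ω u v))

module _ {V : Set} {R : V → V → Set} {ω : V → V → ℚ} where

  infixr 5 _++_
  infixl 5 _∷ʳ_

  _++_ : ∀ {u v x k k′ W W′} → Walk R ω u v k W → Walk R ω v x k′ W′ → Walk R ω u x (k ℕ.+ k′) (W + W′)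
  _++_ {W′ = W′} []      γ′ = subst (Walk R ω _ _ _) (sym (ℚₚ.+-identityˡ W′)) γ′
  _++_ {W′ = W′} (_∷_ {u} {v} {W = W} e γ) γ′ =
    subst (Walk R ω _ _ _) (sym (ℚₚ.+-assoc (ω u v) W W′)) (e ∷ γ ++ γ′)

  _∷ʳ_ : ∀ {u v x k W} → Walk R ω u v k W → R v x → Walk R ω u x (suc k) (W + ω v x)
  _∷ʳ_ {v = v} {x} []      e = subst (Walk R ω _ _ _) (ℚₚ.+-comm (ω v x) 0ℚ) (e ∷ [])
  _∷ʳ_ {v = v} {x} (_∷_ {u} {u′} {W = W} e′ γ) e =
    subst (Walk R ω _ _ _) (sym (ℚₚ.+-assoc (ω u u′) W (ω v x))) (e′ ∷ (γ ∷ʳ e))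

  repeat : ∀ {u k W} j → Walk R ω u u k W → Walk R ω u u (j ℕ.* k) (fromℕ j * W)
  repeat {W = W} zero    γ = subst (Walk R ω _ _ _) (sym (ℚₚ.*-zeroˡ W)) []
  repeat {W = W} (suc j) γ = subst (Walk R ω _ _ _) suc-* (γ ++ repeat j γ)
    where
    suc-* : W + fromℕ j * W ≡ fromℕ (suc j) * W
    suc-* = trans (identity W (fromℕ j)) (cong (_* W) (sym (fromℕ-+ 1 j)))
      where
      identity : ∀ W j → W + j * W ≡ (1ℚ + j) * W
      identity = solve-∀ ℚ-ring

  vertex-at : ∀ {u v k W} → Walk R ω u v k W → Fin (suc k) → V
  vertex-at {u} γ       Fin.zero    = u
  vertex-at     (e ∷ γ) (Fin.suc i) = vertex-at γ i

  record SplitAt (u x v : V) (k₁ k : ℕ) (W : ℚ) : Set where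
    field
      {k₂}    : ℕ
      {W₁ W₂} : ℚ
      before  : Walk R ω u x k₁ W₁
      after   : Walk R ω x v k₂ W₂
      k-sum   : k₁ ℕ.+ k₂ ≡ k
      W-sum   : W₁ + W₂ ≡ W

  split-at : ∀ {u v k W} (γ : Walk R ω u v k W) i → SplitAt u (vertex-at γ i) v (toℕ i) k W
  split-at {W = W} γ Fin.zero = record
    { before = [] ; after = γ ; k-sum = refl ; W-sum = ℚₚ.+-identityˡ W }
  split-at (_∷_ {u} {v} e γ) (Fin.suc i) = record
    { before = e ∷ before ; after = after ; k-sum = cong suc k-sum
    ; W-sum = trans (ℚₚ.+-assoc (ω u v) W₁ W₂) (cong (_+_ (ω u v)) W-sum) }
    where open SplitAt (split-at γ i)

  record Excision (u v : V) (m k : ℕ) (W : ℚ) : Set where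
    field
      {x}      : V
      {l k′}   : ℕ
      {Wˡ W′}  : ℚ
      u⇝x      : Star R u x
      x⇝v      : Star R x v
      excised  : Walk R ω x x (suc l) Wˡ
      rest     : Walk R ω u v k′ W′
      l<m      : suc l ℕ.≤ m
      k-sum    : suc l ℕ.+ k′ ≡ k
      W-sum    : Wˡ + W′ ≡ W

  excise : ∀ {u v k W} (γ : Walk R ω u v k W) {i j} → i Fin.< j → vertex-at γ i ≡ vertex-at γ j →
    Excision u v (toℕ j) k W
  excise {u} {v} γ {Fin.zero} {j@(Fin.suc _)} _ u≡x = record
    { u⇝x = ε ; x⇝v = walk⇒star γ
    ; excised = subst (λ x → Walk R ω u x (toℕ j) W₁) (sym u≡x) before
    ; rest = subst (λ x → Walk R ω x v k₂ W₂) (sym u≡x) after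
    ; l<m = ℕₚ.≤-refl ; k-sum = k-sum ; W-sum = W-sum }
    where open SplitAt (split-at γ j)
  excise (_∷_ {u} {v} e γ) {Fin.suc i} {Fin.suc j} (ℕ.s≤s i<j) same = record
    { u⇝x = e ◅ u⇝x ; x⇝v = x⇝v ; excised = excised ; rest = e ∷ rest
    ; l<m = ℕₚ.m≤n⇒m≤1+n l<m
    ; k-sum = trans (ℕₚ.+-suc (suc l) k′) (cong suc k-sum)
    ; W-sum = trans (+ₚ.x∙yz≈y∙xz Wˡ (ω u v) W′) (cong (_+_ (ω u v)) W-sum) }
    where open Excision (excise γ i<j same)

-- Closed walks

record WalkTo {V : Set} (R : V → V → Set) (ω : V → V → ℚ) (v : V) : Set where
  constructor walkTo
  field
    {source} : V
    {steps}  : ℕ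
    {gain}   : ℚ
    walk     : Walk R ω source v steps gain

star⇒walkTo : ∀ {V : Set} {R : V → V → Set} ω {u v} → Star R u v → WalkTo R ω v
star⇒walkTo ω u⇝v = walkTo (proj₂ (proj₂ (star⇒walk ω u⇝v)))

record Loop {V : Set} (R : V → V → Set) (ω : V → V → ℚ) (v : V) : Set where
  constructor loop
  field
    {steps-1} : ℕ
    {gain}    : ℚ
    walk      : Walk R ω v v (suc steps-1) gain

  steps : ℕ
  steps = suc steps-1

module _ {V : Set} (R : V → V → Set) (ω : V → V → ℚ) (v : V) (q : ℚ) where

  LoopBelow LoopAbove LoopOfMean : Set
  LoopBelow  = Σ[ L ∈ Loop R ω v ] Loop.gain L ℚ.< q * fromℕ (Loop.steps L)
  LoopAbove  = Σ[ L ∈ Loop R ω v ] q * fromℕ (Loop.steps L) ℚ.< Loop.gain L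
  LoopOfMean = Σ[ L ∈ Loop R ω v ] q * fromℕ (Loop.steps L) ≡ Loop.gain L

module _ {V : Set} {R : V → V → Set} {ω : V → V → ℚ} {v : V} where

  opposite-loopBelow⇒loopAbove : ∀ q → LoopBelow R (opposite ω) v (- q) → LoopAbove R ω v q
  opposite-loopBelow⇒loopAbove q (L@(loop {gain = W} γ) , W<-q*k) = loop (unoppose-walk γ) ,
    subst (ℚ._< - W) (-[-p*q]≡p*q q (fromℕ (Loop.steps L))) (ℚₚ.neg-antimono-< W<-q*k)

  opposite-loopOfMean : ∀ q → LoopOfMean R (opposite ω) v q → LoopOfMean R ω v (- q)
  opposite-loopOfMean q (L@(loop γ) , q*k≡W) = loop (unoppose-walk γ) ,
    trans (sym (ℚₚ.neg-distribˡ-* q (fromℕ (Loop.steps L)))) (cong -_ q*k≡W)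

deviation : ℚ → ℕ → ℚ → ℚ
deviation q k W = W - q * fromℕ k

deviation-+ : ∀ q k k′ W W′ → deviation q (k ℕ.+ k′) (W + W′) ≡ deviation q k W + deviation q k′ W′
deviation-+ q k k′ W W′ = trans (cong (λ p → W + W′ - p) (*-distribˡ-fromℕ-+ q k k′))
  (identity W W′ (q * fromℕ k) (q * fromℕ k′))
  where
  identity : ∀ W W′ p p′ → W + W′ - (p + p′) ≡ (W - p) + (W′ - p′)
  identity = solve-∀ ℚ-ring

deviation-* : ∀ q j k W → deviation q (j ℕ.* k) (fromℕ j * W) ≡ fromℕ j * deviation q k W
deviation-* q j k W = trans (cong (λ p → fromℕ j * W - q * p) (fromℕ-* j k)) (identity q (fromℕ j) (fromℕ k) W)
  where
  identity : ∀ q j k W → j * W - q * (j * k) ≡ j * (W - q * k)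
  identity = solve-∀ ℚ-ring

module _ {V : Set} {R : V → V → Set} {ω : V → V → ℚ} where

  walkBelow⇒loopBelow : ∀ q {v k W} → Walk R ω v v k W → W ℚ.< q * fromℕ k → LoopBelow R ω v q
  walkBelow⇒loopBelow q []      0<q*0 = contradiction 0<q*0 (ℚₚ.<-irrefl (sym (ℚₚ.*-zeroʳ q)))
  walkBelow⇒loopBelow q (e ∷ γ) W<q*k = loop (e ∷ γ) , W<q*k

  -- Repeating the loop often enough outweighs the detour through it.
  detour-below : ∀ q {v u k₁ k₂ W₁ W₂} → Walk R ω v u k₁ W₁ → LoopBelow R ω u q → Walk R ω u v k₂ W₂ →
    LoopBelow R ω v q
  detour-below q {k₁ = k₁} {k₂} {W₁} {W₂} γ₁ (L@(loop {gain = W} γ) , W<q*k) γ₂ =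
    let (j , d₁+d₂<j*-d) = archimedean 0<-d (d₁ + d₂) in
    walkBelow⇒loopBelow q (γ₁ ++ (repeat j γ ++ γ₂)) (p-q<0⇒p<q (begin-strict
      deviation q (k₁ ℕ.+ (j ℕ.* k ℕ.+ k₂)) (W₁ + (fromℕ j * W + W₂))  ≡⟨ deviation-sum j ⟩
      d₁ + (fromℕ j * d + d₂)                                          ≡⟨ regroup d₁ d₂ (fromℕ j) d ⟩
      (d₁ + d₂) - fromℕ j * (- d)                                      <⟨ p<q⇒p-q<0 d₁+d₂<j*-d ⟩
      0ℚ                                                               ∎))
    where
    open ℚₚ.≤-Reasoning
    k : ℕ
    k = Loop.steps L

    d d₁ d₂ : ℚ
    d  = deviation q k W
    d₁ = deviation q k₁ W₁
    d₂ = deviation q k₂ W₂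

    0<-d : 0ℚ ℚ.< - d
    0<-d = ℚₚ.neg-antimono-< (p<q⇒p-q<0 W<q*k)

    deviation-sum : ∀ j →
      deviation q (k₁ ℕ.+ (j ℕ.* k ℕ.+ k₂)) (W₁ + (fromℕ j * W + W₂)) ≡ d₁ + (fromℕ j * d + d₂)
    deviation-sum j = trans (deviation-+ q k₁ (j ℕ.* k ℕ.+ k₂) W₁ (fromℕ j * W + W₂))
      (cong (_+_ d₁) (trans (deviation-+ q (j ℕ.* k) k₂ (fromℕ j * W) W₂) (cong (_+ d₂) (deviation-* q j k W))))

    regroup : ∀ d₁ d₂ j d → d₁ + (j * d + d₂) ≡ (d₁ + d₂) - j * (- d)
    regroup = solve-∀ ℚ-ring

  balanced-loop : ∀ c {v} → LoopBelow R ω v c → LoopAbove R ω v c → LoopOfMean R ω v c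
  balanced-loop c (A@(loop {gain = Wᵃ} γᵃ) , Wᵃ<) (B@(loop {gain = Wᵇ} γᵇ) , <Wᵇ) =
    let (m , n , m*-dᵃ≡n*dᵇ) = commensurable (ℚₚ.neg-antimono-< (p<q⇒p-q<0 Wᵃ<)) (p<q⇒0<q-p <Wᵇ) in
    loop (repeat (suc m) γᵃ ++ repeat (suc n) γᵇ) , sym (x∙y⁻¹≈ε⇒x≈y _ _ (balance m n m*-dᵃ≡n*dᵇ))
    where
    open ≡-Reasoning
    open GroupProperties ℚₚ.+-0-group using (x∙y⁻¹≈ε⇒x≈y)
    a b : ℕ
    a = Loop.steps A
    b = Loop.steps B

    dᵃ dᵇ : ℚ
    dᵃ = deviation c a Wᵃ
    dᵇ = deviation c b Wᵇ

    cancel : ∀ m d → m * d + m * (- d) ≡ 0ℚ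
    cancel = solve-∀ ℚ-ring

    balance : ∀ m n → fromℕ (suc m) * (- dᵃ) ≡ fromℕ (suc n) * dᵇ →
      deviation c (suc m ℕ.* a ℕ.+ suc n ℕ.* b) (fromℕ (suc m) * Wᵃ + fromℕ (suc n) * Wᵇ) ≡ 0ℚ
    balance m n m*-dᵃ≡n*dᵇ = begin
      deviation c (suc m ℕ.* a ℕ.+ suc n ℕ.* b) (fromℕ (suc m) * Wᵃ + fromℕ (suc n) * Wᵇ)
        ≡⟨ deviation-+ c (suc m ℕ.* a) (suc n ℕ.* b) (fromℕ (suc m) * Wᵃ) (fromℕ (suc n) * Wᵇ) ⟩
      deviation c (suc m ℕ.* a) (fromℕ (suc m) * Wᵃ) + deviation c (suc n ℕ.* b) (fromℕ (suc n) * Wᵇ)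
        ≡⟨ cong₂ _+_ (deviation-* c (suc m) a Wᵃ) (deviation-* c (suc n) b Wᵇ) ⟩
      fromℕ (suc m) * dᵃ + fromℕ (suc n) * dᵇ
        ≡⟨ cong (_+_ (fromℕ (suc m) * dᵃ)) m*-dᵃ≡n*dᵇ ⟨
      fromℕ (suc m) * dᵃ + fromℕ (suc m) * (- dᵃ)
        ≡⟨ cancel (fromℕ (suc m)) dᵃ ⟩
      0ℚ ∎

-- Minimal cycle means

p÷q*q≡p : ∀ p q .{{_ : ℚ.NonZero q}} → p ℚ.÷ q * q ≡ p
p÷q*q≡p p q = trans (ℚₚ.*-assoc p (ℚ.1/ q) q) (trans (cong (p *_) (ℚₚ.*-inverseˡ q)) (ℚₚ.*-identityʳ p))

Circuit : {V : Set} (R : V → V → Set) (ω : V → V → ℚ) → V → ℕ → ℚ → Set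
Circuit R ω v k W = ∃[ u ] (Star R v u × Star R u v × Walk R ω u u k W)

record MinimalCycle {V : Set} (R : V → V → Set) (ω : V → V → ℚ) (v : V) : Set where
  field
    {u}     : V
    v⇝u     : Star R v u
    u⇝v     : Star R u v
    mean    : ℚ
    cycle   : LoopOfMean R ω u mean
    minimal : ∀ {k W} → Walk R ω v v k W → mean * fromℕ k ℚ.≤ W

minimalCycle⇒loopBelow : ∀ {V : Set} {R : V → V → Set} {ω v} (m : MinimalCycle R ω v) {q} →
  MinimalCycle.mean m ℚ.< q → LoopBelow R ω v q
minimalCycle⇒loopBelow {ω = ω} m {q} mean<q =
  let (L , mean*k≡W) = cycle in
  detour-below q (WalkTo.walk (star⇒walkTo ω v⇝u))
    (L , subst (ℚ._< q * fromℕ (Loop.steps L)) mean*k≡W (ℚₚ.*-monoˡ-<-pos (fromℕ (Loop.steps L)) mean<q))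
    (WalkTo.walk (star⇒walkTo ω u⇝v))
  where open MinimalCycle m

module _ {n : ℕ} {R : Fin n → Fin n → Set} {ω : Fin n → Fin n → ℚ} where

  edge-weights : List ℚ
  edge-weights = cartesianProductWith ω (allFin n) (allFin n)

  walk-weights : ℕ → List ℚ
  walk-weights zero    = 0ℚ ∷ []
  walk-weights (suc k) = cartesianProductWith _+_ edge-weights (walk-weights k)

  ∈-walk-weights : ∀ {u v k W} → Walk R ω u v k W → W ∈ walk-weights k
  ∈-walk-weights []                = here refl
  ∈-walk-weights (_∷_ {u} {v} _ γ) =
    ∈-cartesianProductWith⁺ _+_ (∈-cartesianProductWith⁺ ω (∈-allFin u) (∈-allFin v)) (∈-walk-weights γ)

  excise-long : ∀ {u v k W} → Walk R ω u v k W → n ℕ.< k → Excision {R = R} {ω} u v n k W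
  excise-long {u} {v} {k} {W} γ n<k =
    let (i , j , i<j , same) = Finₚ.pigeonhole (ℕₚ.n<1+n n) (λ i → vertex-at γ (position i))
        found : Excision {R = R} {ω} u v (toℕ (position j)) k W
        found = excise γ (subst₂ ℕ._<_ (sym (toℕ-position i)) (sym (toℕ-position j)) i<j) same
    in record
      { Excision found
      ; l<m = ℕₚ.≤-trans (Excision.l<m found) (subst (ℕ._≤ n) (sym (toℕ-position j)) (Finₚ.toℕ≤pred[n] j)) }
    where
    position : Fin (suc n) → Fin (suc k)
    position i = inject≤ i (ℕ.s≤s (ℕₚ.<⇒≤ n<k))

    toℕ-position : ∀ i → toℕ (position i) ≡ toℕ i
    toℕ-position i = Finₚ.toℕ-inject≤ i (ℕ.s≤s (ℕₚ.<⇒≤ n<k))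

  module _ {v : Fin n} where

    record CircuitSplit (k : ℕ) (W : ℚ) : Set where
      field
        {l₁ k₂} : ℕ
        {W₁ W₂} : ℚ
        short   : suc l₁ ℕ.≤ n
        first   : Circuit R ω v (suc l₁) W₁
        second  : Circuit R ω v k₂ W₂
        k-sum   : suc l₁ ℕ.+ k₂ ≡ k
        W-sum   : W₁ + W₂ ≡ W

    split-circuit : ∀ {k W} → Circuit R ω v k W → n ℕ.< k → CircuitSplit k W
    split-circuit (u , v⇝u , u⇝v , γ) n<k = record
      { short = l<m ; first = x , v⇝u ◅◅ u⇝x , x⇝v ◅◅ u⇝v , excised ; second = u , v⇝u , u⇝v , rest
      ; k-sum = k-sum ; W-sum = W-sum }
      where open Excision (excise-long γ n<k)

    short-circuit : ∀ {l W} → Circuit R ω v (suc l) W → ∃[ l ] ∃[ W ] (suc l ℕ.≤ n × Circuit R ω v (suc l) W)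
    short-circuit {l} c with suc l ℕₚ.≤? n
    ... | yes l<n = _ , _ , l<n , c
    ... | no l≮n  = _ , _ , short , first
      where open CircuitSplit (split-circuit c (ℕₚ.≰⇒> l≮n))

    short-circuits-suffice : ∀ μ → (∀ {l W} → suc l ℕ.≤ n → Circuit R ω v (suc l) W → μ * fromℕ (suc l) ℚ.≤ W) →
      ∀ {k W} → Circuit R ω v k W → μ * fromℕ k ℚ.≤ W
    short-circuits-suffice μ short-bound {k} =
      <-rec (λ k → ∀ {W} → Circuit R ω v k W → μ * fromℕ k ℚ.≤ W) bound k
      where
      bound : ∀ k → (∀ {k′} → k′ ℕ.< k → ∀ {W} → Circuit R ω v k′ W → μ * fromℕ k′ ℚ.≤ W) →
        ∀ {W} → Circuit R ω v k W → μ * fromℕ k ℚ.≤ W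
      bound zero    shorter-bound (_ , _ , _ , []) = ℚₚ.≤-reflexive (ℚₚ.*-zeroʳ μ)
      bound (suc l) shorter-bound c with suc l ℕₚ.≤? n
      ... | yes l<n = short-bound l<n c
      ... | no l≮n with split-circuit c (ℕₚ.≰⇒> l≮n)
      ...   | record { l₁ = l₁ ; k₂ = k₂ ; short = short ; first = c₁ ; second = c₂
                     ; k-sum = refl ; W-sum = refl } =
        ℚₚ.≤-trans (ℚₚ.≤-reflexive (*-distribˡ-fromℕ-+ μ (suc l₁) k₂))
          (ℚₚ.+-mono-≤ (short-bound short c₁) (shorter-bound (ℕ.s≤s (ℕₚ.m≤n+m k₂ l₁)) c₂))

    minimal-cycle : ExcludedMiddle 0ℓ → Loop R ω v → MinimalCycle R ω v
    minimal-cycle em (loop γ₀) =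
      let (c , (_ , _ , v⇝u , u⇝v , γ) , least) = minimum-in ℚ-totalOrder mean {Short} (λ _ → em) candidates
            (let (l , W , short) = short-circuit (v , ε , ε , γ₀) in (l , W) , short)
      in record
        { v⇝u = v⇝u ; u⇝v = u⇝v ; mean = mean c ; cycle = loop γ , mean-weight c
        ; minimal = λ γ′ → short-circuits-suffice (mean c) (least-mean c least) (v , ε , ε , γ′) }
      where
      Short : ℕ × ℚ → Set
      Short (l , W) = suc l ℕ.≤ n × Circuit R ω v (suc l) W

      mean : ℕ × ℚ → ℚ
      mean (l , W) = W ℚ.÷ fromℕ (suc l)

      mean-weight : ∀ c → mean c * fromℕ (suc (proj₁ c)) ≡ proj₂ c
      mean-weight (l , W) = p÷q*q≡p W (fromℕ (suc l))

      candidates : List (ℕ × ℚ)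
      candidates = concatMap (λ l → map (l ,_) (walk-weights (suc l))) (upTo n)

      least-mean : ∀ c → (∀ {c′} → c′ ∈ candidates → Short c′ → mean c ℚ.≤ mean c′) →
        ∀ {l W} → suc l ℕ.≤ n → Circuit R ω v (suc l) W → mean c * fromℕ (suc l) ℚ.≤ W
      least-mean c least {l} {W} l<n circuit@(_ , _ , _ , γ) =
        subst (mean c * fromℕ (suc l) ℚ.≤_) (mean-weight (l , W))
          (*-fromℕ-monoˡ-≤ (suc l) (least {l , W} listed (l<n , circuit)))
        where
        listed : (l , W) ∈ candidates
        listed = ∈-concatMap⁺ _ (lose (∈-upTo⁺ l<n) (∈-map⁺ _ (∈-walk-weights γ)))

-- Infinite paths

IsPath : {V : Set} → (V → V → Set) → (ℕ → V) → Set
IsPath R ρ = ∀ t → R (ρ t) (ρ (suc t))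

pathWeight : {V : Set} → (V → V → ℚ) → (ℕ → V) → ℕ → ℚ
pathWeight ω ρ zero    = 0ℚ
pathWeight ω ρ (suc k) = pathWeight ω ρ k + ω (ρ k) (ρ (suc k))

pathWeight-+ : ∀ {V : Set} (ω : V → V → ℚ) ρ N k →
  pathWeight ω ρ (k ℕ.+ N) ≡ pathWeight ω (λ t → ρ (t ℕ.+ N)) k + pathWeight ω ρ N
pathWeight-+ ω ρ N zero    = sym (ℚₚ.+-identityˡ _)
pathWeight-+ ω ρ N (suc k) = trans (cong (_+ ω (ρ (k ℕ.+ N)) (ρ (suc k ℕ.+ N))) (pathWeight-+ ω ρ N k))
  (+ₚ.xy∙z≈xz∙y (pathWeight ω (λ t → ρ (t ℕ.+ N)) k) (pathWeight ω ρ N) (ω (ρ (k ℕ.+ N)) (ρ (suc k ℕ.+ N))))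

pathWeight-opposite : ∀ {V : Set} (ω : V → V → ℚ) ρ k → pathWeight (opposite ω) ρ k ≡ - pathWeight ω ρ k
pathWeight-opposite ω ρ zero    = refl
pathWeight-opposite ω ρ (suc k) = trans (cong (_- ω (ρ k) (ρ (suc k))) (pathWeight-opposite ω ρ k))
  (sym (ℚₚ.neg-distrib-+ (pathWeight ω ρ k) _))

module _ {V : Set} {R : V → V → Set} where

  path⇒walk : ∀ ω {ρ} → IsPath R ρ → ∀ k → Walk R ω (ρ 0) (ρ k) k (pathWeight ω ρ k)
  path⇒walk ω step zero    = []
  path⇒walk ω step (suc k) = path⇒walk ω step k ∷ʳ step k

  path⇒star : ∀ {ρ} → IsPath R ρ → ∀ {i j} → i ℕ.≤ j → Star R (ρ i) (ρ j)
  path⇒star {ρ} step {i} {j} i≤j = subst (λ t → Star R (ρ i) (ρ t)) (ℕₚ.m∸n+n≡m i≤j)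
    (walk⇒star (path⇒walk (λ _ _ → 0ℚ) {λ t → ρ (t ℕ.+ i)} (λ t → step (t ℕ.+ i)) (j ℕ.∸ i)))

module _ (em : ExcludedMiddle 0ℓ) {n : ℕ} where

  -- A walk that can be closed up loses at most what the closing walk gains.
  closable-walks-above : ∀ {R : Fin n → Fin n → Set} {ω v μ} →
    (∀ {k W} → Walk R ω v v k W → μ * fromℕ k ℚ.≤ W) →
    ∃[ C ] (∀ u {k W} → Star R u v → Walk R ω v u k W → Above (fromℚ μ) C k W)
  closable-walks-above {R} {ω} {v} {μ} closed-above = uniform-bound ℚ-totalOrder 0ℚ {P = BoundedTo}
    (λ _ C≤C′ bounds u⇝v γ → above-weaken C≤C′ (bounds u⇝v γ)) bounded-to
    where
    BoundedTo : Fin n → ℚ → Set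
    BoundedTo u C = ∀ {k W} → Star R u v → Walk R ω v u k W → Above (fromℚ μ) C k W

    bounded-to : ∀ u → ∃[ C ] BoundedTo u C
    bounded-to u with em {Star R u v}
    ... | no ¬u⇝v = 0ℚ , λ u⇝v → contradiction u⇝v ¬u⇝v
    ... | yes u⇝v =
      let (k₀ , W₀ , γ₀) = star⇒walk ω u⇝v ; (D , detach) = above-detach (fromℚ μ) k₀ W₀ in
      0ℚ + D , λ {k} {W} _ γ → detach W (≤fromℚ⇒above (λ _ l → l) (closed-above (γ ++ γ₀)))

  recurrent-path-above : ∀ {R : Fin n → Fin n → Set} {ω ρ μ} → IsPath R ρ →
    ∀ N → (∀ i → N ℕ.≤ i → Star R (ρ i) (ρ N)) → (∀ {k W} → Walk R ω (ρ N) (ρ N) k W → μ * fromℕ k ℚ.≤ W) →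
    ∃[ C ] (∀ k → N ℕ.≤ k → Above (fromℚ μ) C k (pathWeight ω ρ k))
  recurrent-path-above {R} {ω} {ρ} {μ} step N back closed-above =
    let (C , tails) = closable-walks-above closed-above
        (C₀ , beginning) = above-exists (fromℚ μ) N (pathWeight ω ρ N)

        above-+N : ∀ j → Above (fromℚ μ) (C + C₀) (j ℕ.+ N) (pathWeight ω ρ (j ℕ.+ N))
        above-+N j = subst (Above (fromℚ μ) (C + C₀) (j ℕ.+ N)) (sym (pathWeight-+ ω ρ N j))
          (above-+ (tails _ (back _ (ℕₚ.m≤n+m N j)) (path⇒walk ω (λ t → step (t ℕ.+ N)) j)) beginning)
    in C + C₀ , λ k N≤k → subst (λ k → Above (fromℚ μ) (C + C₀) k (pathWeight ω ρ k)) (ℕₚ.m∸n+n≡m N≤k)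
      (above-+N (k ℕ.∸ N))

  eventually-recurrent : (ρ : ℕ → Fin n) → ∃[ N ] (∀ i → N ℕ.≤ i → ∀ j → ∃[ t ] (j ℕ.≤ t × ρ t ≡ ρ i))
  eventually-recurrent ρ = let (N , settled) = uniform-bound ℕₚ.≤-totalOrder 0 settled-mono settles in
    N , λ i N≤i → recurs (settled (ρ i)) N≤i
    where
    Settled : Fin n → ℕ → Set
    Settled u N = (∀ t → N ℕ.≤ t → ρ t ≢ u) ⊎ (∀ j → ∃[ t ] (j ℕ.≤ t × ρ t ≡ u))

    settles : ∀ u → ∃[ N ] Settled u N
    settles u with em {∃[ N ] (∀ t → N ℕ.≤ t → ρ t ≢ u)}
    ... | yes (N , never) = N , inj₁ never
    ... | no  ¬never      = 0 , inj₂ λ j → decidable-stable em λ none →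
      ¬never (j , λ t j≤t ρt≡u → none (t , j≤t , ρt≡u))

    settled-mono : ∀ u {N N′} → N ℕ.≤ N′ → Settled u N → Settled u N′
    settled-mono u N≤N′ (inj₁ never) = inj₁ λ t N′≤t → never t (ℕₚ.≤-trans N≤N′ N′≤t)
    settled-mono u N≤N′ (inj₂ again) = inj₂ again

    recurs : ∀ {i N} → Settled (ρ i) N → N ℕ.≤ i → ∀ j → ∃[ t ] (j ℕ.≤ t × ρ t ≡ ρ i)
    recurs {i} (inj₁ never) N≤i = contradiction refl (never i N≤i)
    recurs     (inj₂ again) _   = again

data LoopsAround {V : Set} (R : V → V → Set) (ω : V → V → ℚ) (v : V) (x : ℝ) : Set where
  attained   : ∀ c {u} → x ≈ fromℚ c → Star R v u → LoopOfMean R ω u c → LoopsAround R ω v x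
  straddling : ∀ {r s} → lower x r → LoopBelow R ω v r → upper x s → LoopAbove R ω v s → LoopsAround R ω v x

module _ (em : ExcludedMiddle 0ℓ) {n : ℕ} {R : Fin n → Fin n → Set} {ω : Fin n → Fin n → ℚ} where
  open ClassicalReals em

  -- The greatest cycle mean is the negated least cycle mean for the opposite weights.
  liminf⇒loopsAround : ∀ {ρ} → IsPath R ρ → ∀ {N} → (∀ i → N ℕ.≤ i → Star R (ρ i) (ρ N)) →
    ∀ (average : ℕ → ℚ) {x} → (∀ k → average k * fromℕ (suc k) ≡ pathWeight ω ρ (suc k)) →
    IsLiminf (λ k → fromℚ (average k)) x → LoopsAround R ω (ρ N) x
  liminf⇒loopsAround {ρ} step {N} back average {x} average*k≡W payoff =
    around (minimal-cycle em (loop return)) (minimal-cycle em (loop (oppose-walk return)))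
    where
    open LiminfOfAverages (pathWeight ω ρ) average average*k≡W
    open MinimalCycle

    return : Walk R ω (ρ N) (ρ N) _ _
    return = step N ∷ WalkTo.walk (star⇒walkTo ω (back (suc N) (ℕₚ.n≤1+n N)))

    least≤x : (m : MinimalCycle R ω (ρ N)) → fromℚ (mean m) ≤ x
    least≤x m = liminf-≥ {fromℚ (mean m)} {x} payoff
      (proj₂ (recurrent-path-above em {ω = ω} {ρ} step N back (minimal m)))

    x≤greatest : (m : MinimalCycle R (opposite ω) (ρ N)) → x ≤ fromℚ (- mean m)
    x≤greatest m =
      let (C , bounds) = recurrent-path-above em {ω = opposite ω} {ρ} step N back (minimal m) in
      liminf-≤ {fromℚ (- mean m)} {x} payoff λ k N≤k → fromℚ-above⇒below (mean m)
        (subst (Above (fromℚ (mean m)) C k) (pathWeight-opposite ω ρ k) (bounds k N≤k))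

    around : MinimalCycle R ω (ρ N) → MinimalCycle R (opposite ω) (ρ N) → LoopsAround R ω (ρ N) x
    around m m⁻ with ≤-or-> x (fromℚ (mean m)) | ≤-or-> (fromℚ (- mean m⁻)) x
    ... | inj₁ x≤least | _               = attained (mean m) (x≤least , least≤x m) (v⇝u m) (cycle m)
    ... | inj₂ _       | inj₁ greatest≤x = attained (- mean m⁻) (x≤greatest m⁻ , greatest≤x)
      (v⇝u m⁻) (opposite-loopOfMean (mean m⁻) (cycle m⁻))
    ... | inj₂ (r , least<r , lr) | inj₂ (s , us , s<greatest) =
      straddling lr (minimalCycle⇒loopBelow m least<r)
        us (opposite-loopBelow⇒loopAbove s (minimalCycle⇒loopBelow m⁻ (p<-q⇒q<-p s<greatest)))

-- Paths made of loops

module _ {V : Set} {R : V → V → Set} {ω : V → V → ℚ} where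

  AllSuffixes : (ℕ → ℚ → Set) → ∀ {u v k W} → Walk R ω u v k W → Set
  AllSuffixes P []                            = P 0 0ℚ
  AllSuffixes P (_∷_ {u} {v} {k = k} {W} _ γ) = P (suc k) (ω u v + W) × AllSuffixes P γ

  allSuffixes-whole : ∀ {P u v k W} (γ : Walk R ω u v k W) → AllSuffixes P γ → P k W
  allSuffixes-whole []      p       = p
  allSuffixes-whole (_ ∷ _) (p , _) = p

  allSuffixes-map : ∀ {P Q : ℕ → ℚ → Set} → (∀ {k W} → P k W → Q k W) →
    ∀ {u v k W} (γ : Walk R ω u v k W) → AllSuffixes P γ → AllSuffixes Q γ
  allSuffixes-map f []      p        = f p
  allSuffixes-map f (_ ∷ γ) (p , ps) = f p , allSuffixes-map f γ ps

  allSuffixes-uniform : ∀ {P : ℚ → ℕ → ℚ → Set} → (∀ {C C′ k W} → C ℚ.≤ C′ → P C k W → P C′ k W) →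
    (∀ k W → ∃[ C ] P C k W) → ∀ {u v k W} (γ : Walk R ω u v k W) → ∃[ C ] AllSuffixes (P C) γ
  allSuffixes-uniform mono p []      = p 0 0ℚ
  allSuffixes-uniform mono p (_ ∷ γ) =
    let (C , whole) = p _ _ ; (C′ , rest) = allSuffixes-uniform mono p γ in
    C ⊔ C′ , mono (ℚₚ.p≤p⊔q C C′) whole , allSuffixes-map (mono (ℚₚ.p≤q⊔p C C′)) γ rest

module Looping {V : Set} {R : V → V → Set} {ω : V → V → ℚ} {v : V}
  (approach : WalkTo R ω v) (choose : ℕ → ℚ → Loop R ω v) where

  open WalkTo

  advance : Loop R ω v → WalkTo R ω v → WalkTo R ω v
  advance _              (walkTo (_ ∷ γ)) = walkTo γ
  advance (loop (_ ∷ γ)) (walkTo [])      = walkTo γ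

  advance-edge : ∀ L p → R (source p) (source (advance L p))
  advance-edge _              (walkTo (e ∷ _)) = e
  advance-edge (loop (e ∷ _)) (walkTo [])      = e

  -- What is left of the current loop after t steps, and the gain of these steps.
  pending : ℕ → WalkTo R ω v
  gained  : ℕ → ℚ
  pending zero    = approach
  pending (suc t) = advance (choose t (gained t)) (pending t)
  gained zero    = 0ℚ
  gained (suc t) = gained t + ω (source (pending t)) (source (pending (suc t)))

  looping : ℕ → V
  looping t = source (pending t)

  looping-isPath : IsPath R looping
  looping-isPath t = advance-edge (choose t (gained t)) (pending t)

  gained≡pathWeight : ∀ t → gained t ≡ pathWeight ω looping t
  gained≡pathWeight zero    = refl
  gained≡pathWeight (suc t) = cong (_+ ω (looping t) (looping (suc t))) (gained≡pathWeight t)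

  looping-invariant : (Inv : ℕ → ℚ → Set) → Inv (steps approach) (gain approach) →
    (∀ k W → Inv k W → Inv (k ℕ.+ Loop.steps (choose k W)) (W + Loop.gain (choose k W))) →
    ∀ t → Inv (t ℕ.+ steps (pending t)) (gained t + gain (pending t))
  looping-invariant Inv initially preserved zero    = subst (Inv _) (sym (ℚₚ.+-identityˡ _)) initially
  looping-invariant Inv initially preserved (suc t) = after (choose t (gained t)) (pending t)
    (looping-invariant Inv initially preserved t) (preserved t (gained t))
    where
    after : ∀ L p → Inv (t ℕ.+ steps p) (gained t + gain p) →
      (Inv t (gained t) → Inv (t ℕ.+ Loop.steps L) (gained t + Loop.gain L)) →
      Inv (suc t ℕ.+ steps (advance L p))
          (gained t + ω (source p) (source (advance L p)) + gain (advance L p))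
    after _ (walkTo (_∷_ {k = k} {W} _ _)) inv _ =
      subst₂ Inv (ℕₚ.+-suc t k) (sym (ℚₚ.+-assoc (gained t) _ W)) inv
    after (loop (_∷_ {k = k} {W} _ _)) (walkTo []) inv next =
      subst₂ Inv (ℕₚ.+-suc t k) (sym (ℚₚ.+-assoc (gained t) _ W))
        (next (subst₂ Inv (ℕₚ.+-identityʳ t) (ℚₚ.+-identityʳ (gained t)) inv))

  looping-suffixes : ∀ {P} → AllSuffixes P (walk approach) → (∀ k W → AllSuffixes P (Loop.walk (choose k W))) →
    ∀ t → AllSuffixes P (walk (pending t))
  looping-suffixes     initially loops zero    = initially
  looping-suffixes {P} initially loops (suc t) =
    after (choose t (gained t)) (pending t) (loops t (gained t)) (looping-suffixes initially loops t)
    where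
    after : ∀ L p → AllSuffixes P (Loop.walk L) → AllSuffixes P (walk p) → AllSuffixes P (walk (advance L p))
    after _              (walkTo (_ ∷ _)) _        (_ , ps) = ps
    after (loop (_ ∷ _)) (walkTo [])      (_ , ps) _        = ps

module _ {V : Set} {R : V → V → Set} {ω : V → V → ℚ} {v : V} where

  looping-within : ∀ {a b C} (approach : WalkTo R ω v) →
    ∀ {n} (loops : Fin n → Loop R ω v) (choice : ℕ → ℚ → Fin n) →
    Within a b C (WalkTo.steps approach) (WalkTo.gain approach) →
    (∀ k W → Within a b C k W →
      let L = loops (choice k W) in Within a b C (k ℕ.+ Loop.steps L) (W + Loop.gain L)) →
    ∃[ C′ ] (∀ t → Within a b C′ t (pathWeight ω (Looping.looping approach λ k W → loops (choice k W)) t))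
  looping-within {a} {b} {C} approach loops choice initially preserved =
    let (D₀ , approach-detachable) = allSuffixes-detachable (walk approach)
        (D₁ , loops-detachable) = uniform-bound ℚ-totalOrder 0ℚ
          (λ i D≤D′ → allSuffixes-map (detachable-mono D≤D′) (Loop.walk (loops i)))
          (λ i → allSuffixes-detachable (Loop.walk (loops i)))
        suffixes : ∀ t → AllSuffixes (Detachable (D₀ ⊔ D₁)) (walk (pending t))
        suffixes = looping-suffixes
          (allSuffixes-map (detachable-mono (ℚₚ.p≤p⊔q D₀ D₁)) (walk approach) approach-detachable)
          (λ k W → allSuffixes-map (detachable-mono (ℚₚ.p≤q⊔p D₀ D₁)) (Loop.walk (loops (choice k W)))
            (loops-detachable (choice k W)))
    in C + (D₀ ⊔ D₁) , λ t → subst (Within a b (C + (D₀ ⊔ D₁)) t) (gained≡pathWeight t)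
      (allSuffixes-whole (walk (pending t)) (suffixes t) (gained t)
        (looping-invariant (Within a b C) initially preserved t))
    where
    open Looping approach (λ k W → loops (choice k W))
    open WalkTo

    Detachable : ℚ → ℕ → ℚ → Set
    Detachable D k₀ W₀ = ∀ {C k} W → Within a b C (k ℕ.+ k₀) (W + W₀) → Within a b (C + D) k W

    detachable-mono : ∀ {D D′ k₀ W₀} → D ℚ.≤ D′ → Detachable D k₀ W₀ → Detachable D′ k₀ W₀
    detachable-mono D≤D′ detach {C} W h = within-weaken (ℚₚ.+-monoʳ-≤ C D≤D′) (detach W h)

    allSuffixes-detachable : ∀ {u v k W} (γ : Walk R ω u v k W) → ∃[ D ] AllSuffixes (Detachable D) γ
    allSuffixes-detachable = allSuffixes-uniform detachable-mono within-detach

  constant-looping-within : ∀ c (approach : WalkTo R ω v) ((L , _) : LoopOfMean R ω v c) →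
    ∃[ C ] (∀ t → Within (fromℚ c) (fromℚ c) C t (pathWeight ω (Looping.looping approach λ _ _ → L) t))
  constant-looping-within c approach (L , c*k≡W) =
    let (C , initially) = within-exists {fromℚ c} {fromℚ c} (WalkTo.steps approach) (WalkTo.gain approach) in
    looping-within approach {1} (λ _ → L) (λ _ _ → 0F) initially λ k W h →
      subst (λ C → Within (fromℚ c) (fromℚ c) C (k ℕ.+ Loop.steps L) (W + Loop.gain L)) (ℚₚ.+-identityʳ C)
        (within-+ h (within-mean c*k≡W))

  -- Taking the first loop when W ≥ c k and the second one otherwise keeps W - c k bounded.
  greedy-looping-within : ExcludedMiddle 0ℓ → ∀ c (approach : WalkTo R ω v) (A B : Loop R ω v) →
    Below c 0ℚ (Loop.steps A) (Loop.gain A) → Above c 0ℚ (Loop.steps B) (Loop.gain B) →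
    Σ[ choose ∈ (ℕ → ℚ → Loop R ω v) ]
      ∃[ C ] (∀ t → Within c c C t (pathWeight ω (Looping.looping approach choose) t))
  greedy-looping-within em c approach A B belowᵃ aboveᵇ = (λ k W → loops (choice k W)) ,
    looping-within approach loops choice
      (within-weaken (ℚₚ.p≤p⊔q C₀ (Cᵃ ⊔ Cᵇ)) (proj₂ initially)) λ k W → preserved em
    where
    open Loop

    loops : Fin 2 → Loop R ω v
    loops 0F = A
    loops 1F = B

    pick : ∀ {k W} → Dec (Above c 0ℚ k W) → Fin 2
    pick (yes _) = 0F
    pick (no _)  = 1F

    choice : ℕ → ℚ → Fin 2
    choice k W = pick (em {Above c 0ℚ k W})

    initially : ∃[ C ] Within c c C (WalkTo.steps approach) (WalkTo.gain approach)
    initially = within-exists (WalkTo.steps approach) (WalkTo.gain approach)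

    withinᵃ : ∃[ C ] Within c c C (steps A) (gain A)
    withinᵃ = within-exists (steps A) (gain A)

    withinᵇ : ∃[ C ] Within c c C (steps B) (gain B)
    withinᵇ = within-exists (steps B) (gain B)

    C₀ Cᵃ Cᵇ C : ℚ
    C₀ = proj₁ initially
    Cᵃ = proj₁ withinᵃ
    Cᵇ = proj₁ withinᵇ
    C  = C₀ ⊔ (Cᵃ ⊔ Cᵇ)

    preserved : ∀ {k W} (side : Dec (Above c 0ℚ k W)) → Within c c C k W →
      Within c c C (k ℕ.+ steps (loops (pick side))) (W + gain (loops (pick side)))
    preserved {W = W} (yes aboveᵏ) (_ , belowᵏ) = within-+-down {W = W} {gain A}
      (ℚₚ.≤-trans (ℚₚ.p≤p⊔q Cᵃ Cᵇ) (ℚₚ.p≤q⊔p C₀ (Cᵃ ⊔ Cᵇ))) aboveᵏ belowᵏ (within-above (proj₂ withinᵃ)) belowᵃ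
    preserved {W = W} (no ¬aboveᵏ) (aboveᵏ , _) = within-+-up {W = W} {gain B}
      (ℚₚ.≤-trans (ℚₚ.p≤q⊔p Cᵃ Cᵇ) (ℚₚ.p≤q⊔p C₀ (Cᵃ ⊔ Cᵇ))) aboveᵏ (¬above⇒below c ¬aboveᵏ)
      aboveᵇ (within-below (proj₂ withinᵇ))

module _ {V : Set} {R : V → V → Set} {ω : V → V → ℚ} {v : V} (approach : WalkTo R ω v) (L : Loop R ω v) where
  open Looping approach (λ _ _ → L)
  open WalkTo

  runs-out : ∀ k t → steps (pending t) ≡ k → pending (t ℕ.+ k) ≡ walkTo []
  runs-out zero    t none = subst (λ s → pending s ≡ walkTo []) (sym (ℕₚ.+-identityʳ t))
    (empty (pending t) none)
    where
    empty : ∀ p → steps p ≡ 0 → p ≡ walkTo []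
    empty (walkTo []) refl = refl
  runs-out (suc k) t left = subst (λ s → pending s ≡ walkTo []) (sym (ℕₚ.+-suc t k))
    (runs-out k (suc t) (shorter (pending t) left))
    where
    shorter : ∀ p → steps p ≡ suc k → steps (advance L p) ≡ k
    shorter (walkTo (_ ∷ _)) refl = refl

  looping-periodic : ∀ t → looping (t ℕ.+ (steps approach ℕ.+ Loop.steps L)) ≡ looping (t ℕ.+ steps approach)
  looping-periodic t = cong source (pending-periodic t)
    where
    k₀ : ℕ
    k₀ = steps approach

    home : pending k₀ ≡ walkTo []
    home = runs-out k₀ 0 refl

    steps-after-home : ∀ L → steps (advance L (walkTo [])) ≡ Loop.steps-1 L
    steps-after-home (loop (_ ∷ _)) = refl

    home-again : pending (k₀ ℕ.+ Loop.steps L) ≡ walkTo []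
    home-again = subst (λ t → pending t ≡ walkTo []) (sym (ℕₚ.+-suc k₀ (Loop.steps-1 L)))
      (runs-out (Loop.steps-1 L) (suc k₀) (trans (cong (λ p → steps (advance L p)) home) (steps-after-home L)))

    pending-periodic : ∀ t → pending (t ℕ.+ (k₀ ℕ.+ Loop.steps L)) ≡ pending (t ℕ.+ k₀)
    pending-periodic zero    = trans home-again (sym home)
    pending-periodic (suc t) = cong (advance L) (pending-periodic t)

-- Rational points of intervals

lower-em : ExcludedMiddle (lsuc 0ℓ) → ExcludedMiddle 0ℓ
lower-em em {P} = map′ unlift lift (em {Lift (lsuc 0ℓ) P})

fromℚ-mono-≤ : ∀ {p q} → p ℚ.≤ q → fromℚ p ≤ fromℚ q
fromℚ-mono-≤ p≤q _ r<p = ℚₚ.<-≤-trans r<p p≤q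

module _ (em : ExcludedMiddle (lsuc 0ℓ)) where
  open ClassicalReals (lower-em em)

  rational-point-near : ∀ {I x r s} → NotIrrationalPoint I → x ∈ᴵ I → lower x r → upper x s →
    ∃[ c ] (fromℚ c ∈ᴵ I × r ℚ.≤ c × c ℚ.≤ s)
  rational-point-near {I} {x} {r} {s} not-irrational x∈I lr us
    with em {Σ[ y ∈ ℝ ] (y ∈ᴵ I × ¬ (y ≈ x))}
  ... | no alone = singleton (not-irrational x x∈I λ y y∈I →
      decidable-stable (lower-em em) λ y≉x → alone (y , y∈I , y≉x))
    where
    singleton : ∃[ q ] x ≈ fromℚ q → ∃[ c ] (fromℚ c ∈ᴵ I × r ℚ.≤ c × c ℚ.≤ s)
    singleton (q , x≤q , q≤x) = q , ∈ᴵ-convex I x∈I x∈I x≤q q≤x ,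
      ℚₚ.<⇒≤ (x≤q r lr) , ℚₚ.<⇒≤ (≤-upper {fromℚ q} {x} q≤x us)
  ... | yes (y , y∈I , y≉x) = beside (≉⇒<⊎> {x} {y} y≉x)
    where
    beside : x < y ⊎ y < x → ∃[ c ] (fromℚ c ∈ᴵ I × r ℚ.≤ c × c ℚ.≤ s)
    beside (inj₁ (q , uq , lq)) = q ⊓ s , ∈ᴵ-convex I x∈I y∈I (upper⇒≤fromℚ x u) q⊓s≤y ,
      ℚₚ.<⇒≤ (lower<upper x lr u) , ℚₚ.p⊓q≤q q s
      where
      u : upper x (q ⊓ s)
      u = upper-⊓ x uq us
      q⊓s≤y : fromℚ (q ⊓ s) ≤ y
      q⊓s≤y = ≤-trans {fromℚ (q ⊓ s)} {fromℚ q} {y} (fromℚ-mono-≤ (ℚₚ.p⊓q≤p q s)) (lower⇒fromℚ≤ y lq)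
    beside (inj₂ (q , uq , lq)) = q ⊔ r , ∈ᴵ-convex I y∈I x∈I y≤q⊔r (lower⇒fromℚ≤ x l) ,
      ℚₚ.p≤q⊔p q r , ℚₚ.<⇒≤ (lower<upper x l us)
      where
      l : lower x (q ⊔ r)
      l = lower-⊔ x lq lr
      y≤q⊔r : y ≤ fromℚ (q ⊔ r)
      y≤q⊔r = ≤-trans {y} {fromℚ q} {fromℚ (q ⊔ r)} (upper⇒≤fromℚ y uq) (fromℚ-mono-≤ (ℚₚ.p≤p⊔q q r))

-- Finite memory

Finite : Set → Set
Finite S = ∃[ n ] S ↪ Fin n

finite-Fin : ∀ n → Finite (Fin n)
finite-Fin n = n , ↪-id (Fin n)

finite-⊤ : Finite ⊤
finite-⊤ = 1 , ↔⇒↪ (↔-sym Finₚ.1↔⊤)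

finite-× : ∀ {S T} → Finite S → Finite T → Finite (S × T)
finite-× (m , S↪m) (n , T↪n) = m ℕ.* n , ↔⇒↪ (↔-sym Finₚ.*↔×) ↪-∘ (S↪m ×-↪ T↪n)

finite-⊎ : ∀ {S T} → Finite S → Finite T → Finite (S ⊎ T)
finite-⊎ (m , S↪m) (n , T↪n) = m ℕ.+ n , ↔⇒↪ (↔-sym Finₚ.+↔⊎) ↪-∘ (S↪m ⊎-↪ T↪n)

module _ (G : GameGraph) where
  open GameGraph G

  module _ {S : Set} (s₀ : S) (update : S → V → S) where

    state : ∀ {v} → Prefix G v → S
    state {v} (start _) = update s₀ v
    state {v} (h ▷ _)   = update (state h) v

    finite⇒finiteMemory : Finite S → (output : S → V) → ∀ {p} {σ : Strategy G p} →
      (∀ {v} (h : Prefix G v) (o : Owns G p v) → proj₁ (σ h o) ≡ output (state h)) → FiniteMemory G {p} σ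
    finite⇒finiteMemory (n , S↪n) output σ≡ = machine , λ h o →
      trans (σ≡ h o) (cong output (sym (decode-run h)))
      where
      open RightInverse S↪n using () renaming (to to encode; from to decode; strictlyInverseʳ to decode-encode)

      machine : Machine G
      machine = record
        { size = n ; initial = encode s₀
        ; update = λ i v → encode (update (decode i) v) ; output = λ i → output (decode i) }

      decode-run : ∀ {v} (h : Prefix G v) → decode (run G machine h) ≡ state h
      decode-run {v} (start _) = trans (decode-encode _) (cong (λ s → update s v) (decode-encode s₀))
      decode-run {v} (h ▷ _)   = trans (decode-encode _) (cong (λ s → update s v) (decode-run h))

  -- Edge weights

  edge-weight : V → V → ℚ
  edge-weight u v with Boolₚ.T? (E u v)
  ... | yes e = fromℤ (w e)
  ... | no _  = 0ℚ

  edge-weight-≡ : ∀ {u v} (e : Edge u v) → edge-weight u v ≡ fromℤ (w e)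
  edge-weight-≡ {u} {v} e with Boolₚ.T? (E u v)
  ... | yes e′ = cong (λ e → fromℤ (w e)) (Boolₚ.T-irrelevant e′ e)
  ... | no ¬e  = contradiction e ¬e

  weight≡pathWeight : ∀ π k → fromℤ (weight G π k) ≡ pathWeight edge-weight (Play.vertex π) k
  weight≡pathWeight π zero    = refl
  weight≡pathWeight π (suc k) = trans (fromℤ-+ (weight G π k) (w (Play.step π k)))
    (cong₂ _+_ (weight≡pathWeight π k) (sym (edge-weight-≡ (Play.step π k))))

  average*k≡pathWeight : ∀ π k → average G π k * fromℕ (suc k) ≡ pathWeight edge-weight (Play.vertex π) (suc k)
  average*k≡pathWeight π k = trans (i/n*n≡i (weight G π (suc k)) (suc k)) (weight≡pathWeight π (suc k))

  owner : ∀ u → Owns G eve u ⊎ Owns G adam u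
  owner u with V∃ u
  ... | true  = inj₁ refl
  ... | false = inj₂ refl

  ¬both-own : ∀ {u} → Owns G eve u → ¬ Owns G adam u
  ¬both-own is-eve is-adam = contradiction (trans (sym is-eve) is-adam) λ ()

  owns-irrelevant : ∀ {p u} (o o′ : Owns G p u) → o ≡ o′
  owns-irrelevant {eve}  = Decidable⇒UIP.≡-irrelevant Boolₚ._≟_
  owns-irrelevant {adam} = Decidable⇒UIP.≡-irrelevant Boolₚ._≟_

  -- Two strategies against each other

  module Versus (σ : Strategy G adam) (τ : Strategy G eve) where

    reply : ∀ {v} → Prefix G v → ∃[ u ] Edge v u
    reply {v} h with owner v
    ... | inj₁ is-eve  = τ h is-eve
    ... | inj₂ is-adam = σ h is-adam

    history : ℕ → ∃[ v ] Prefix G v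
    history zero    = q₀ , start refl
    history (suc k) = let (v , h) = history k ; (u , e) = reply h in u , h ▷ e

    play : Play G
    play = record
      { vertex = λ k → proj₁ (history k)
      ; starts = refl
      ; step   = λ k → proj₂ (reply (proj₂ (history k))) }

    prefix-play : ∀ k → prefix G play k ≡ proj₂ (history k)
    prefix-play zero    = refl
    prefix-play (suc k) = cong (_▷ Play.step play k) (prefix-play k)

    consistent-eve : Consistent G {eve} τ play
    consistent-eve k o rewrite prefix-play k with history k
    ... | v , h with owner v
    ...   | inj₁ is-eve  = cong (λ o → proj₁ (τ h o)) (owns-irrelevant {eve} is-eve o)
    ...   | inj₂ is-adam = contradiction is-adam (¬both-own o)

    consistent-adam : Consistent G {adam} σ play
    consistent-adam k o rewrite prefix-play k with history k
    ... | v , h with owner v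
    ...   | inj₁ is-eve  = contradiction o (¬both-own is-eve)
    ...   | inj₂ is-adam = cong (λ o → proj₁ (σ h o)) (owns-irrelevant {adam} is-adam o)

  ¬both-win : ∀ {I} (σ : Strategy G adam) (τ : Strategy G eve) → Winning G I {adam} σ → ¬ Winning G I {eve} τ
  ¬both-win σ τ σ-wins τ-wins = σ-wins play consistent-adam (τ-wins play consistent-eve)
    where open Versus σ τ

  -- Controllers for Eve

  -- Unlike a Machine, a controller sees the current vertex besides its memory.
  record Controller : Set₁ where
    field
      Memory   : Set
      initial  : Memory
      update   : Memory → V → V → Memory
      response : Memory → (v : V) → ∃[ u ] Edge v u

  open Controller public

  -- A set of moves restricts Adam only; it contains the move from u to v as combine u v.
  Moves : Set
  Moves = Subset (order ℕ.* order)

  Allowed : Moves → V → V → Set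
  Allowed p u v = Edge u v × (Owns G adam u → combine u v Subset.∈ p)

  data Run (p : Moves) (K : Controller) : Memory K → V → ℕ → ℚ → Set where
    outset : Run p K (initial K) q₀ 0 0ℚ
    move   : ∀ {s u v k W} → Run p K s u k W → Allowed p u v →
      (Owns G eve u → v ≡ proj₁ (response K s u)) → Run p K (update K s u v) v (suc k) (W + edge-weight u v)

  record EveWins (I : Interval) (p : Moves) : Set₁ where
    field
      controller : Controller
      finite     : NotIrrationalPoint I → Finite (Memory controller)
      {a b}      : ℝ
      a∈I        : a ∈ᴵ I
      b∈I        : b ∈ᴵ I
      C          : ℚ
      within     : ∀ {s v k W} → Run p controller s v k W → Within a b C k W

  module ControllerStrategy (K : Controller) where

    memory : ∀ {v} → Prefix G v → Memory K
    memory (start _)         = initial K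
    memory (_▷_ {u} {v} h _) = update K (memory h) u v

    strategy : Strategy G eve
    strategy {v} h _ = response K (memory h) v

    strategy-run : ∀ π → Consistent G {eve} strategy π → ∀ k →
      Run full K (memory (prefix G π k)) (Play.vertex π k) k (pathWeight edge-weight (Play.vertex π) k)
    strategy-run π consistent zero    = subst (λ v → Run full K (initial K) v 0 0ℚ) (sym (Play.starts π)) outset
    strategy-run π consistent (suc k) =
      move (strategy-run π consistent k) (Play.step π k , λ _ → ∈⊤) (consistent k)

    -- Nothing has been read in the state inj₁ tt.
    read : ⊤ ⊎ Memory K × V → V → ⊤ ⊎ Memory K × V
    read (inj₁ _)       v = inj₂ (initial K , v)
    read (inj₂ (s , u)) v = inj₂ (update K s u v , v)

    respond : ⊤ ⊎ Memory K × V → V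
    respond (inj₁ _)       = q₀
    respond (inj₂ (s , v)) = proj₁ (response K s v)

    state≡memory : ∀ {v} (h : Prefix G v) → state (inj₁ tt) read h ≡ inj₂ (memory h , v)
    state≡memory (start _)     = refl
    state≡memory {v} (h ▷ _) = cong (λ s → read s v) (state≡memory h)

    strategy-finiteMemory : Finite (Memory K) → FiniteMemory G {eve} strategy
    strategy-finiteMemory finite = finite⇒finiteMemory (inj₁ tt) read
      (finite-⊎ finite-⊤ (finite-× finite (finite-Fin order))) respond
      {eve} {λ {v} → strategy {v}} λ h _ → cong respond (sym (state≡memory h))

  eveWins⇒winning : ExcludedMiddle 0ℓ → ∀ {I} (E : EveWins I full) →
    Winning G I {eve} (ControllerStrategy.strategy (EveWins.controller E))
  eveWins⇒winning em {I} E π consistent =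
    let (x , payoff) = within⇒liminf em bounds in
    x , payoff , ∈ᴵ-convex I a∈I b∈I
      (liminf-≥ {a} {x} {N = 0} payoff λ k _ → within-above (bounds k))
      (liminf-≤ {b} {x} {N = 0} payoff λ k _ → within-below (bounds k))
    where
    open EveWins E
    open LiminfOfAverages (pathWeight edge-weight (Play.vertex π)) (average G π) (average*k≡pathWeight π)

    bounds : ∀ k → Within a b C k (pathWeight edge-weight (Play.vertex π) k)
    bounds k = within (ControllerStrategy.strategy-run controller π consistent k)

  -- Deleting a move of Adam

  allowed-∖ : ∀ {p v y u u′} → Allowed p u u′ → ¬ (u ≡ v × u′ ≡ y) → Allowed (p ∖ combine v y) u u′
  allowed-∖ {v = v} {y} {u} {u′} (e , u′∈p) ≢vy = e , λ o →
    x∈p∧x≢y⇒x∈p-y (u′∈p o) λ same → ≢vy (Finₚ.combine-injective u u′ v y same)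

  run-∖ : ∀ {p v y K} → ¬ (∃[ s ] ∃[ k ] ∃[ W ] Run (p ∖ combine v y) K s v k W) →
    ∀ {s u k W} → Run p K s u k W → Run (p ∖ combine v y) K s u k W
  run-∖ unvisited outset       = outset
  run-∖ unvisited (move r e o) = move (run-∖ unvisited r)
    (allowed-∖ e λ { (refl , _) → unvisited (_ , _ , _ , run-∖ unvisited r) }) o

  Available : Moves → V → V → Set
  Available p v u = Edge v u × combine v u Subset.∈ p

  Unblocked : Moves → Set
  Unblocked p = ∀ v → Owns G adam v → ∃[ u ] Available p v u

  unblocked-∖ : ∀ {p v u u′} → Unblocked p → Available p v u → u ≢ u′ → Unblocked (p ∖ combine v u′)
  unblocked-∖ {v = v} {u} {u′} unblocked (e , u∈p) u≢u′ x x-adam with x Finₚ.≟ v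
  ... | yes refl = u , e , x∈p∧x≢y⇒x∈p-y u∈p (u≢u′ ∘ Finₚ.combine-injectiveʳ v u v u′)
  ... | no x≢v   = let (y , e′ , y∈p) = unblocked x x-adam in
    y , e′ , x∈p∧x≢y⇒x∈p-y y∈p (x≢v ∘ Finₚ.combine-injectiveˡ x y v u′)

  -- Shuffling two controllers

  pattern first  = Fin.zero
  pattern second = Fin.suc Fin.zero

  -- The move v → u₂ hands the play over to K₂, and any other move from v hands it over to K₁.
  module Shuffling {p : Moves} {v u₁ u₂ : V} (v-adam : Owns G adam v) (u₁≢u₂ : u₁ ≢ u₂)
    (K₁ K₂ : Controller) where

    Mode : Set
    Mode = Fin 2

    p₁ p₂ : Moves
    p₁ = p ∖ combine v u₂
    p₂ = p ∖ combine v u₁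

    next-mode : Mode → V → V → Mode
    next-mode m u u′ with u Finₚ.≟ v | u′ Finₚ.≟ u₂
    ... | no _  | _     = m
    ... | yes _ | yes _ = second
    ... | yes _ | no _  = first

    update-active : Mode → Memory K₁ × Memory K₂ → V → V → Memory K₁ × Memory K₂
    update-active first  (s₁ , s₂) u u′ = update K₁ s₁ u u′ , s₂
    update-active second (s₁ , s₂) u u′ = s₁ , update K₂ s₂ u u′

    -- The play of K₂ is taken up where it visits v.
    module _ {s₂ k₀ W₀} (visit : Run p₂ K₂ s₂ v k₀ W₀) where

      shuffled : Controller
      shuffled = record
        { Memory   = Mode × Memory K₁ × Memory K₂
        ; initial  = first , initial K₁ , s₂
        ; update   = λ (m , s) u u′ → next-mode m u u′ , update-active (next-mode m u u′) s u u′
        ; response = λ { (first , s₁ , _) → response K₁ s₁ ; (second , _ , s₂) → response K₂ s₂ }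
        }

      -- The play that is not being continued waits at v.
      position₁ position₂ : Mode → V → V
      position₁ first  u = u
      position₁ second u = v
      position₂ first  u = v
      position₂ second u = u

      record Tracks (m : Mode) (s : Memory K₁ × Memory K₂) (u : V) (k : ℕ) (W : ℚ) : Set where
        field
          {k₁ k₂} : ℕ
          {W₁ W₂} : ℚ
          run₁    : Run p₁ K₁ (proj₁ s) (position₁ m u) k₁ W₁
          run₂    : Run p₂ K₂ (proj₂ s) (position₂ m u) k₂ W₂
          k-sum   : k₁ ℕ.+ k₂ ≡ k ℕ.+ k₀
          W-sum   : W₁ + W₂ ≡ W + W₀

      tracks-at-v : ∀ {m s k W} m′ → Tracks m s v k W → Tracks m′ s v k W
      tracks-at-v {m} {s} m′ t = record
        { run₁ = subst (λ x → Run p₁ K₁ (proj₁ s) x k₁ W₁) (trans (at-v₁ m) (sym (at-v₁ m′))) run₁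
        ; run₂ = subst (λ x → Run p₂ K₂ (proj₂ s) x k₂ W₂) (trans (at-v₂ m) (sym (at-v₂ m′))) run₂
        ; k-sum = k-sum ; W-sum = W-sum }
        where
        open Tracks t
        at-v₁ : ∀ m → position₁ m v ≡ v
        at-v₁ first  = refl
        at-v₁ second = refl
        at-v₂ : ∀ m → position₂ m v ≡ v
        at-v₂ first  = refl
        at-v₂ second = refl

      active-moves : Mode → Moves
      active-moves first  = p₁
      active-moves second = p₂

      switch : ∀ {m s u k W} u′ → Tracks m s u k W → Allowed p u u′ →
        Tracks (next-mode m u u′) s u k W × Allowed (active-moves (next-mode m u u′)) u u′ ×
        (Owns G eve u → next-mode m u u′ ≡ m)
      switch {m} {u = u} u′ t e with u Finₚ.≟ v | u′ Finₚ.≟ u₂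
      ... | yes refl | yes refl = tracks-at-v second t , allowed-∖ e (≢-sym u₁≢u₂ ∘ proj₂) ,
        λ v-eve → contradiction v-adam (¬both-own v-eve)
      ... | yes refl | no u′≢u₂ = tracks-at-v first t , allowed-∖ e (u′≢u₂ ∘ proj₂) ,
        λ v-eve → contradiction v-adam (¬both-own v-eve)
      switch {first}  u′ t e | no u≢v | _ = t , allowed-∖ e (u≢v ∘ proj₁) , λ _ → refl
      switch {second} u′ t e | no u≢v | _ = t , allowed-∖ e (u≢v ∘ proj₁) , λ _ → refl

      tracks-move : ∀ m {s u u′ k W} → Tracks m s u k W → Allowed (active-moves m) u u′ →
        (Owns G eve u → u′ ≡ proj₁ (response shuffled (m , s) u)) →
        Tracks m (update-active m s u u′) u′ (suc k) (W + edge-weight u u′)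
      tracks-move first {u = u} {u′} {W = W} t e o = record
        { run₁ = move run₁ e o ; run₂ = run₂ ; k-sum = cong suc k-sum
        ; W-sum = trans (+ₚ.xy∙z≈xz∙y W₁ z W₂) (trans (cong (_+ z) W-sum) (+ₚ.xy∙z≈xz∙y W W₀ z)) }
        where
        open Tracks t
        z : ℚ
        z = edge-weight u u′
      tracks-move second {u = u} {u′} {W = W} t e o = record
        { run₁ = run₁ ; run₂ = move run₂ e o ; k-sum = trans (ℕₚ.+-suc k₁ k₂) (cong suc k-sum)
        ; W-sum = trans (sym (ℚₚ.+-assoc W₁ W₂ z)) (trans (cong (_+ z) W-sum) (+ₚ.xy∙z≈xz∙y W W₀ z)) }
        where
        open Tracks t
        z : ℚ
        z = edge-weight u u′

      run-tracks : ∀ {m s u k W} → Run p shuffled (m , s) u k W → Tracks m s u k W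
      run-tracks outset = record { run₁ = outset ; run₂ = visit ; k-sum = refl ; W-sum = refl }
      run-tracks (move {m , s} {u} {u′} r e o) with switch u′ (run-tracks r) e
      ... | t , e′ , same = tracks-move (next-mode m u u′) t e′ λ u-eve →
        trans (o u-eve) (cong (λ m → proj₁ (response shuffled (m , s) u)) (sym (same u-eve)))

      shuffled-within : ∀ {a b C₁ C₂} →
        (∀ {s u k W} → Run p₁ K₁ s u k W → Within a b C₁ k W) →
        (∀ {s u k W} → Run p₂ K₂ s u k W → Within a b C₂ k W) →
        ∃[ C ] (∀ {s u k W} → Run p shuffled s u k W → Within a b C k W)
      shuffled-within {a} {b} {C₁} {C₂} within₁ within₂ =
        let (D , detach) = within-detach k₀ W₀ in
        C₁ + C₂ + D , λ {_} {_} {_} {W} r → detach W (tracked (run-tracks r))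
        where
        tracked : ∀ {m s u k W} → Tracks m s u k W → Within a b (C₁ + C₂) (k ℕ.+ k₀) (W + W₀)
        tracked t = subst₂ (Within a b (C₁ + C₂)) k-sum W-sum (within-+ (within₁ run₁) (within₂ run₂))
          where open Tracks t

  module _ (em : ExcludedMiddle 0ℓ) (I : Interval) where
    open ClassicalReals em

    minimum-∈ᴵ : ∀ {a a′} → a ∈ᴵ I → a′ ∈ᴵ I → Σ[ m ∈ ℝ ] (m ∈ᴵ I × m ≤ a × m ≤ a′)
    minimum-∈ᴵ {a} {a′} a∈I a′∈I with ≤-or-> a a′
    ... | inj₁ a≤a′ = a , a∈I , (λ _ l → l) , a≤a′
    ... | inj₂ a′<a = a′ , a′∈I , <⇒≤ {a′} {a} a′<a , (λ _ l → l)

    maximum-∈ᴵ : ∀ {b b′} → b ∈ᴵ I → b′ ∈ᴵ I → Σ[ m ∈ ℝ ] (m ∈ᴵ I × b ≤ m × b′ ≤ m)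
    maximum-∈ᴵ {b} {b′} b∈I b′∈I with ≤-or-> b b′
    ... | inj₁ b≤b′ = b′ , b′∈I , b≤b′ , (λ _ l → l)
    ... | inj₂ b′<b = b , b∈I , (λ _ l → l) , <⇒≤ {b′} {b} b′<b

    eveWins-shuffle : ∀ {p v u₁ u₂} → Owns G adam v → u₁ ≢ u₂ →
      EveWins I (p ∖ combine v u₂) → EveWins I (p ∖ combine v u₁) → EveWins I p
    eveWins-shuffle {p} {v} {u₁} v-adam u₁≢u₂ E₁ E₂
      with em {∃[ s ] ∃[ k ] ∃[ W ] Run (p ∖ combine v u₁) (EveWins.controller E₂) s v k W}
    ... | no unvisited = record { EveWins E₂ ; within = λ r → EveWins.within E₂ (run-∖ unvisited r) }
    ... | yes (_ , _ , _ , visit) =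
      let (a , a∈I , a≤a₁ , a≤a₂) = minimum-∈ᴵ E₁.a∈I E₂.a∈I
          (b , b∈I , b₁≤b , b₂≤b) = maximum-∈ᴵ E₁.b∈I E₂.b∈I
          (C , within) = shuffled-within visit
            (λ r → within-mono a≤a₁ b₁≤b (E₁.within r)) (λ r → within-mono a≤a₂ b₂≤b (E₂.within r)) in
      record
        { controller = shuffled visit
        ; finite     = λ not-irrational →
            finite-× (finite-Fin 2) (finite-× (E₁.finite not-irrational) (E₂.finite not-irrational))
        ; a∈I = a∈I ; b∈I = b∈I ; C = C ; within = within }
      where
      module E₁ = EveWins E₁
      module E₂ = EveWins E₂
      open Shuffling v-adam u₁≢u₂ E₁.controller E₂.controller

  -- Adam without choice

  Forced : Moves → Set
  Forced p = ∀ {u x y} → Owns G adam u → Allowed p u x → Allowed p u y → x ≡ y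

  -- Setting a clock for ρ back is allowed when ρ goes on in the same way.
  record Clock (ρ : ℕ → V) : Set₁ where
    field
      Time          : Set
      reading       : Time → ℕ
      start-time    : Time
      tick          : Time → Time
      reading-start : reading start-time ≡ 0
      reading-tick  : ∀ s j → ρ (j ℕ.+ reading (tick s)) ≡ ρ (j ℕ.+ suc (reading s))

  counting-clock : ∀ {ρ} → Clock ρ
  counting-clock = record
    { Time = ℕ ; reading = λ t → t ; start-time = 0 ; tick = suc
    ; reading-start = refl ; reading-tick = λ _ _ → refl }

  lasso-clock : ∀ {ρ p n} → p ℕ.< n → (∀ j → ρ (j ℕ.+ n) ≡ ρ (j ℕ.+ p)) → Clock ρ
  lasso-clock {ρ} {p} {n} p<n periodic = record
    { Time = Fin n ; reading = toℕ ; start-time = fromℕ< 0<n ; tick = next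
    ; reading-start = Finₚ.toℕ-fromℕ< 0<n ; reading-tick = reading-next }
    where
    0<n : 0 ℕ.< n
    0<n = ℕₚ.≤-<-trans ℕ.z≤n p<n

    next : Fin n → Fin n
    next i with suc (toℕ i) ℕₚ.<? n
    ... | yes i<n = fromℕ< i<n
    ... | no _    = fromℕ< p<n

    reading-next : ∀ i j → ρ (j ℕ.+ toℕ (next i)) ≡ ρ (j ℕ.+ suc (toℕ i))
    reading-next i j with suc (toℕ i) ℕₚ.<? n
    ... | yes i<n = cong (λ t → ρ (j ℕ.+ t)) (Finₚ.toℕ-fromℕ< i<n)
    ... | no i≮n  = begin
      ρ (j ℕ.+ toℕ (fromℕ< p<n))  ≡⟨ cong (λ t → ρ (j ℕ.+ t)) (Finₚ.toℕ-fromℕ< p<n) ⟩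
      ρ (j ℕ.+ p)                 ≡⟨ periodic j ⟨
      ρ (j ℕ.+ n)                 ≡⟨ cong (λ t → ρ (j ℕ.+ t)) (ℕₚ.≤-antisym (Finₚ.toℕ<n i) (ℕₚ.≮⇒≥ i≮n)) ⟨
      ρ (j ℕ.+ suc (toℕ i))       ∎
      where open ≡-Reasoning

  module Following {p : Moves} (forced : Forced p) {ρ : ℕ → V} (ρ-starts : ρ 0 ≡ q₀)
    (ρ-step : IsPath (Allowed p) ρ) (clock : Clock ρ) where
    open Clock clock

    follow-response : Time → (v : V) → ∃[ u ] Edge v u
    follow-response s v with ρ (reading s) Finₚ.≟ v
    ... | yes refl = ρ (suc (reading s)) , proj₁ (ρ-step (reading s))
    ... | no  _    = total v

    follow-response-on-path : ∀ s {v} → ρ (reading s) ≡ v → proj₁ (follow-response s v) ≡ ρ (suc (reading s))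
    follow-response-on-path s {v} ρs≡v with ρ (reading s) Finₚ.≟ v
    ... | yes refl = refl
    ... | no ρs≢v  = contradiction ρs≡v ρs≢v

    follow : Controller
    follow = record
      { Memory = Time ; initial = start-time ; update = λ s _ _ → tick s ; response = follow-response }

    run-follows : ∀ {s u k W} → Run p follow s u k W →
      u ≡ ρ k × W ≡ pathWeight edge-weight ρ k × (∀ j → ρ (j ℕ.+ reading s) ≡ ρ (j ℕ.+ k))
    run-follows outset = sym ρ-starts , refl , λ j → cong (λ t → ρ (j ℕ.+ t)) reading-start
    run-follows (move {s} {u} {v} {k} r e o) with run-follows r
    ... | refl , refl , on-time = v≡ , cong (λ v → pathWeight edge-weight ρ k + edge-weight (ρ k) v) v≡ ,
      λ j → begin
        ρ (j ℕ.+ reading (tick s))  ≡⟨ reading-tick s j ⟩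
        ρ (j ℕ.+ suc (reading s))   ≡⟨ cong ρ (ℕₚ.+-suc j (reading s)) ⟩
        ρ (suc j ℕ.+ reading s)     ≡⟨ on-time (suc j) ⟩
        ρ (suc j ℕ.+ k)             ≡⟨ cong ρ (ℕₚ.+-suc j k) ⟨
        ρ (j ℕ.+ suc k)             ∎
      where
      open ≡-Reasoning
      v≡ : v ≡ ρ (suc k)
      v≡ with owner (ρ k)
      ... | inj₁ is-eve  = trans (o is-eve) (trans (follow-response-on-path s (on-time 0)) (on-time 1))
      ... | inj₂ is-adam = forced is-adam e (ρ-step k)

    follow-eveWins : ∀ {I} → (NotIrrationalPoint I → Finite Time) → ∀ {c C} → c ∈ᴵ I →
      (∀ k → Within c c C k (pathWeight edge-weight ρ k)) → EveWins I p
    follow-eveWins finite {c} {C} c∈I within = record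
      { controller = follow ; finite = finite ; a∈I = c∈I ; b∈I = c∈I ; C = C
      ; within = λ {_} {_} {k} r →
          let (_ , W≡ , _) = run-follows r in subst (Within c c C k) (sym W≡) (within k) }

  module _ {I : Interval} {p : Moves} (forced : Forced p) where

    loopOfMean⇒eveWins : ∀ c {v} → fromℚ c ∈ᴵ I → Star (Allowed p) q₀ v →
      LoopOfMean (Allowed p) edge-weight v c → EveWins I p
    loopOfMean⇒eveWins c {v} c∈I q₀⇝v (L , c*k≡W) =
      follow-eveWins (λ _ → finite-Fin _) c∈I (proj₂ (constant-looping-within c approach (L , c*k≡W)))
      where
      approach : WalkTo (Allowed p) edge-weight v
      approach = star⇒walkTo edge-weight q₀⇝v
      open WalkTo approach using (steps)
      open Looping approach (λ _ _ → L)
      open Following forced {looping} refl looping-isPath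
        (lasso-clock (ℕₚ.m<m+n steps ℕ.z<s) (looping-periodic approach L))

    loopsBetween⇒eveWins : ExcludedMiddle 0ℓ → ∀ c {v} → c ∈ᴵ I → ¬ NotIrrationalPoint I →
      Star (Allowed p) q₀ v → (A B : Loop (Allowed p) edge-weight v) →
      Below c 0ℚ (Loop.steps A) (Loop.gain A) → Above c 0ℚ (Loop.steps B) (Loop.gain B) → EveWins I p
    loopsBetween⇒eveWins em c {v} c∈I irrational q₀⇝v A B below above =
      let (choose , _ , within) = greedy-looping-within em c approach A B below above
          open Looping approach choose
          open Following forced {looping} refl looping-isPath counting-clock
      in follow-eveWins (λ not-irrational → contradiction not-irrational irrational) c∈I within
      where
      approach : WalkTo (Allowed p) edge-weight v
      approach = star⇒walkTo edge-weight q₀⇝v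

    loopsAround⇒eveWins : ExcludedMiddle (lsuc 0ℓ) → ∀ {v x} → Star (Allowed p) q₀ v → x ∈ᴵ I →
      LoopsAround (Allowed p) edge-weight v x → EveWins I p
    loopsAround⇒eveWins em {v} {x} q₀⇝v x∈I (attained c (x≤c , c≤x) v⇝u L) =
      loopOfMean⇒eveWins c (∈ᴵ-convex I x∈I x∈I x≤c c≤x) (q₀⇝v ◅◅ v⇝u) L
    loopsAround⇒eveWins em {v} {x} q₀⇝v x∈I (straddling lr (A , Wᵃ<r*k) us (B , s*k<Wᵇ))
      with em {NotIrrationalPoint I}
    ... | no irrational = loopsBetween⇒eveWins (lower-em em) x x∈I irrational q₀⇝v A B
      (fromℚ≤⇒below x (lower⇒fromℚ≤ x lr) (ℚₚ.<⇒≤ Wᵃ<r*k)) (≤fromℚ⇒above (upper⇒≤fromℚ x us) (ℚₚ.<⇒≤ s*k<Wᵇ))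
    ... | yes not-irrational =
      let (c , c∈I , r≤c , c≤s) = rational-point-near em not-irrational x∈I lr us in
      loopOfMean⇒eveWins c c∈I q₀⇝v (balanced-loop c
        (A , ℚₚ.<-≤-trans Wᵃ<r*k (*-fromℕ-monoˡ-≤ (Loop.steps A) r≤c))
        (B , ℚₚ.≤-<-trans (*-fromℕ-monoˡ-≤ (Loop.steps B) c≤s) s*k<Wᵇ))

    won-play⇒eveWins : ExcludedMiddle (lsuc 0ℓ) → (π : Play G) → IsPath (Allowed p) (Play.vertex π) →
      WonBy G I eve π → EveWins I p
    won-play⇒eveWins em π legal (x , payoff , x∈I) =
      let (N , recurs) = eventually-recurrent (lower-em em) vertex
          q₀⇝vN : Star (Allowed p) q₀ (vertex N)
          q₀⇝vN = subst (λ u → Star (Allowed p) u (vertex N)) starts (path⇒star legal ℕ.z≤n)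
          back : ∀ i → N ℕ.≤ i → Star (Allowed p) (vertex i) (vertex N)
          back i _ = returns i (recurs N ℕₚ.≤-refl i)
      in loopsAround⇒eveWins em q₀⇝vN x∈I
        (liminf⇒loopsAround (lower-em em) legal back (average G π) (average*k≡pathWeight π) payoff)
      where
      open Play π using (vertex; starts)
      returns : ∀ i {u} → ∃[ t ] (i ℕ.≤ t × vertex t ≡ u) → Star (Allowed p) (vertex i) u
      returns i (t , i≤t , refl) = path⇒star legal i≤t

  -- Determinacy

  AdamWinsPositionally : Interval → Set₁
  AdamWinsPositionally I = Σ[ σ ∈ Strategy G adam ] (Positional G {adam} σ × Winning G I {adam} σ)

  unblocked⇒allowed : ∀ {p} → Unblocked p → ∀ v → ∃[ u ] Allowed p v u
  unblocked⇒allowed unblocked v with owner v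
  ... | inj₁ v-eve  = let (u , e) = total v in u , e , λ v-adam → contradiction v-adam (¬both-own v-eve)
  ... | inj₂ v-adam = let (u , e , u∈p) = unblocked v v-adam in u , e , λ _ → u∈p

  module _ (em : ExcludedMiddle (lsuc 0ℓ)) {I : Interval} where

    forced⇒eveWins : ¬ AdamWinsPositionally I → ∀ {p} → Forced p → Unblocked p → EveWins I p
    forced⇒eveWins ¬adam-wins {p} forced unblocked =
      refuted (em {Σ[ π ∈ Play G ] (Consistent G {adam} σ π × WonBy G I eve π)})
      where
      only-move : ∀ v → ∃[ u ] Allowed p v u
      only-move = unblocked⇒allowed unblocked

      σ : Strategy G adam
      σ {v} _ _ = let (u , e , _) = only-move v in u , e

      refuted : Dec (Σ[ π ∈ Play G ] (Consistent G {adam} σ π × WonBy G I eve π)) → EveWins I p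
      refuted (no none) = contradiction
        (σ , ((λ v → proj₁ (only-move v)) , λ _ _ → refl) ,
          λ π consistent won → none (π , consistent , won)) ¬adam-wins
      refuted (yes (π , consistent , won)) = won-play⇒eveWins forced em π legal won
        where
        legal : IsPath (Allowed p) (Play.vertex π)
        legal t = Play.step π t , λ o → subst (λ u → combine (Play.vertex π t) u Subset.∈ p)
          (sym (consistent t o)) (proj₂ (proj₂ (only-move (Play.vertex π t))) o)

    unblocked⇒eveWins : ¬ AdamWinsPositionally I → ∀ p → Acc _⊂_ p → Unblocked p → EveWins I p
    unblocked⇒eveWins ¬adam-wins p (acc smaller) unblocked
      with lower-em em {∃[ v ] ∃[ u₁ ] ∃[ u₂ ] (Owns G adam v × u₁ ≢ u₂ × Available p v u₁ × Available p v u₂)}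
    ... | yes (v , u₁ , u₂ , v-adam , u₁≢u₂ , move₁@(_ , u₁∈p) , move₂@(_ , u₂∈p)) =
      eveWins-shuffle (lower-em em) I v-adam u₁≢u₂
        (unblocked⇒eveWins ¬adam-wins _ (smaller (x∈p⇒p-x⊂p u₂∈p)) (unblocked-∖ unblocked move₁ u₁≢u₂))
        (unblocked⇒eveWins ¬adam-wins _ (smaller (x∈p⇒p-x⊂p u₁∈p)) (unblocked-∖ unblocked move₂ (≢-sym u₁≢u₂)))
    ... | no ¬choice = forced⇒eveWins ¬adam-wins (λ {u} {x} {y} → forced {u} {x} {y}) unblocked
      where
      forced : Forced p
      forced {u} {x} {y} u-adam (e , x∈p) (e′ , y∈p) = decidable-stable (x Finₚ.≟ y) λ x≢y →
        ¬choice (u , x , y , u-adam , x≢y , (e , x∈p u-adam) , (e′ , y∈p u-adam))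

    determinacy : AdamWinsPositionally I ⊎ EveWins I full
    determinacy with em {AdamWinsPositionally I}
    ... | yes adam-wins = inj₁ adam-wins
    ... | no ¬adam-wins = inj₂ (unblocked⇒eveWins ¬adam-wins full (⊂-wellFounded full)
      λ u _ → let (v , e) = total u in v , e , ∈⊤)

mainTheorem7 : ExcludedMiddle (lsuc 0ℓ) → (G : GameGraph) (I : Interval) →
    ( (Σ[ σ ∈ Strategy G adam ] Winning G I {adam} σ) →
      Σ[ σ ∈ Strategy G adam ] (Positional G {adam} σ × Winning G I {adam} σ) )
    ×
    ( NotIrrationalPoint I →
      (Σ[ σ ∈ Strategy G eve ] Winning G I {eve} σ) →
      Σ[ σ ∈ Strategy G eve ] (FiniteMemory G {eve} σ × Winning G I {eve} σ) )
mainTheorem7 em G I with determinacy G em {I}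
... | inj₁ adam-wins@(σ , _ , σ-wins) =
  (λ _ → adam-wins) , λ _ (τ , τ-wins) → contradiction τ-wins (¬both-win G σ τ σ-wins)
... | inj₂ E =
  (λ (σ , σ-wins) → contradiction strategy-wins (¬both-win G σ strategy σ-wins)) ,
  λ not-irrational _ → strategy , strategy-finiteMemory (finite not-irrational) , strategy-wins
  where
  open EveWins E using (controller; finite)
  open ControllerStrategy G controller
  strategy-wins : Winning G I {eve} strategy
  strategy-wins = eveWins⇒winning G (lower-em em) E
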